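{- A connected graph $G$ is a $3$-leaf power if and only if (1) its split tree $ST(G)=(T,\mathcal{F})$ is a clique-star tree; (2) the set of star nodes of $T$ induces a connected subtree of $T$; and (3) for every star node $u$, the tree-edge $e$ with $\rho_u(e)$ the centre of $G_u$ has as its other endpoint a leaf or a clique node.
   Context: A graph $G$ is a $k$-leaf power if there is a tree whose leaf set is $V(G)$ such that $xy\in E(G)$ iff the distance in the tree between $x$ and $y$ is at most $k$. A graph-labelled tree $(T,\mathcal{F})$: a tree $T$ whose internal vertices (nodes) $v$ of degree $k$ carry a graph $G_v$ on $k$ marker vertices and a bijection $\rho_v$ from tree-edges at $v$ to $V(G_v)$; for a leaf $l$, a node or leaf $u\ne l$ is $l$-accessible if for consecutive tree-edges $e=wv,e'=vw'$ on the $l,u$-path, $\rho_v(e)\rho_v(e')\in E(G_v)$; the accessibility graph has the leaves as vertices, $x,y$ adjacent iff $y$ is $x$-accessible. A split of $H$ is a bipartition $(V_1,V_2)$ of $V(H)$, $|V_i|\ge 2$, such that every vertex of $V_2$ with a neighbour in $V_1$ is adjacent to every vertex of $V_1$ with a neighbour in $V_2$; prime = no split; degenerate = clique or star ($K_{1,m}$, centre = universal vertex, others extremities). Reduced: all nodes of degree $\ge3$, no two adjacent clique nodes, no adjacent star nodes $u,v$ with $\rho_u(uv)$ the centre of $G_u$ and $\rho_v(uv)$ an extremity of $G_v$. The split tree $ST(G)$ is the unique reduced graph-labelled tree with accessibility graph $G$ whose labels are prime or degenerate. A clique-star tree has all labels cliques or stars; clique/star nodes are nodes with clique/star labels. -}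

module Defs where

open import Data.Nat using (ℕ; zero; suc; _≤_)
open import Data.Fin using (Fin)
open import Data.Bool using (Bool; true; false)
open import Data.List using (List; []; _∷_; length; last)
open import Data.List.Relation.Unary.All using (All)
open import Data.List.Relation.Unary.Linked using (Linked)
open import Data.List.Relation.Unary.Unique.Propositional using (Unique)
open import Data.Maybe using (just)
open import Data.Product using (Σ; _×_; _,_; ∃; ∃-syntax)
open import Data.Sum using (_⊎_)
open import Data.Unit using (⊤)
open import Data.Empty using (⊥)
open import Relation.Nullary using (¬_)
open import Relation.Binary.PropositionalEquality using (_≡_; _≢_)
open import Function.Bundles using (_⇔_)

record Graph (n : ℕ) : Set where
  field
    adj    : Fin n → Fin n → Bool
    sym    : ∀ x y → adj x y ≡ adj y x
    irrefl : ∀ x → adj x x ≡ false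
open Graph public

module _ {n : ℕ} (G : Graph n) where

  Adj : Fin n → Fin n → Set
  Adj x y = adj G x y ≡ true

  -- a walk from x to y: the vertex sequence x ∷ ws, consecutive vertices
  -- adjacent, ending in y; it has  length ws  edges
  Walk : Fin n → Fin n → List (Fin n) → Set
  Walk x y ws = Linked Adj (x ∷ ws) × last (x ∷ ws) ≡ just y

  Path : Fin n → Fin n → List (Fin n) → Set
  Path x y ws = Walk x y ws × Unique (x ∷ ws)

  Connected : Set
  Connected = (1 ≤ n) × (∀ x y → ∃[ ws ] Walk x y ws)

  Cycle : List (Fin n) → Set
  Cycle [] = ⊥
  Cycle (v ∷ ws) = (2 ≤ length ws) × Unique (v ∷ ws) × Linked Adj (v ∷ ws)
                   × ∃[ z ] (last (v ∷ ws) ≡ just z × Adj z v)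

  IsTree : Set
  IsTree = Connected × (∀ cs → ¬ Cycle cs)

  IsLeaf : Fin n → Set
  IsLeaf v = ∀ a b → Adj v a → Adj v b → a ≡ b

  DistLeq : Fin n → Fin n → ℕ → Set
  DistLeq x y k = ∃[ ws ] (Walk x y ws × length ws ≤ k)

LeafPower : ℕ → {n : ℕ} → Graph n → Set
LeafPower k {n} G =
  ∃[ m ] Σ (Graph m) λ T → IsTree T ×
    Σ (Fin n → Fin m) λ f →
      (∀ x y → f x ≡ f y → x ≡ y) ×
      (∀ x → IsLeaf T (f x)) ×
      (∀ v → IsLeaf T v → ∃[ x ] f x ≡ v) ×
      (∀ x y → x ≢ y → (Adj G x y ⇔ DistLeq T (f x) (f y) k))

module _ {k : ℕ} (V : Fin k → Set) (E : Fin k → Fin k → Set) where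

  IsClique : Set
  IsClique = ∀ a b → V a → V b → a ≢ b → E a b

  IsCentre : Fin k → Set
  IsCentre c = V c × (∀ a → V a → a ≢ c → E c a)
                   × (∀ a b → V a → V b → a ≢ c → b ≢ c → ¬ E a b)

  IsStar : Set
  IsStar = ∃[ c ] IsCentre c

  IsExtremity : Fin k → Set
  IsExtremity a = IsStar × V a × ¬ IsCentre a

  Degenerate : Set
  Degenerate = IsClique ⊎ IsStar

  Split : Set
  Split = Σ (Fin k → Bool) λ S →
    (∃[ a ] ∃[ b ] (a ≢ b × V a × V b × S a ≡ true × S b ≡ true)) ×
    (∃[ a ] ∃[ b ] (a ≢ b × V a × V b × S a ≡ false × S b ≡ false)) ×
    (∀ a b → V a → V b → S a ≡ false → S b ≡ true →
       (∃[ c ] (V c × S c ≡ true × E a c)) →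
       (∃[ d ] (V d × S d ≡ false × E b d)) →
       E a b)

  Prime : Set
  Prime = ¬ Split

-- Graph-labelled trees whose leaves are Fin n.
-- The marker vertices of the label at node v are identified with the
-- tree-neighbours of v (i.e. with the tree-edges at v, ρ_v being this
-- identification); lab v a b says that the markers of edges va and vb are
-- adjacent in G_v.

record GLT (n : ℕ) : Set where
  field
    m        : ℕ
    T        : Graph m
    isTree   : IsTree T
    leaf     : Fin n → Fin m
    leafInj  : ∀ x y → leaf x ≡ leaf y → x ≡ y
    leafLeaf : ∀ x → IsLeaf T (leaf x)
    leafOnto : ∀ v → IsLeaf T v → ∃[ x ] leaf x ≡ v
    lab      : Fin m → Fin m → Fin m → Bool
    labSym   : ∀ v a b → lab v a b ≡ lab v b a
    labIrr   : ∀ v a → lab v a a ≡ false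

module _ {n : ℕ} (𝒯 : GLT n) where
  open GLT 𝒯

  IsNode : Fin m → Set
  IsNode v = ¬ IsLeaf T v

  LV : Fin m → Fin m → Set
  LV v a = Adj T v a

  LE : Fin m → Fin m → Fin m → Set
  LE v a b = lab v a b ≡ true

  CliqueNode : Fin m → Set
  CliqueNode v = IsNode v × IsClique (LV v) (LE v)

  StarNode : Fin m → Set
  StarNode v = IsNode v × IsStar (LV v) (LE v)

  Triples : (Fin m → Fin m → Fin m → Set) → List (Fin m) → Set
  Triples P (a ∷ rest@(b ∷ c ∷ _)) = P a b c × Triples P rest
  Triples P _ = ⊤

  Accessible : Fin m → Fin m → Set
  Accessible l u = l ≢ u × ∃[ ws ] (Path T l u ws × Triples (λ w v w' → LE v w w') (l ∷ ws))

  Reduced : Set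
  Reduced =
    (∀ v → IsNode v → ∃[ a ] ∃[ b ] ∃[ c ]
        (Adj T v a × Adj T v b × Adj T v c × a ≢ b × a ≢ c × b ≢ c)) ×
    (∀ u v → Adj T u v → CliqueNode u → CliqueNode v → ⊥) ×
    (∀ u v → Adj T u v → StarNode u → StarNode v →
       IsCentre (LV u) (LE u) v → IsExtremity (LV v) (LE v) u → ⊥)

  IsSplitTreeOf : Graph n → Set
  IsSplitTreeOf G =
    Reduced ×
    (∀ v → IsNode v → Prime (LV v) (LE v) ⊎ Degenerate (LV v) (LE v)) ×
    (∀ x y → x ≢ y → (Adj G x y ⇔ Accessible (leaf x) (leaf y)))

  CliqueStarTree : Set
  CliqueStarTree = ∀ v → IsNode v → CliqueNode v ⊎ StarNode v

  StarNodesConnected : Set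
  StarNodesConnected = ∀ u w → StarNode u → StarNode w →
    ∃[ ws ] (Walk T u w ws × All StarNode (u ∷ ws))

  CentresOK : Set
  CentresOK = ∀ u → StarNode u → ∀ c → IsCentre (LV u) (LE u) c →
    IsLeaf T c ⊎ CliqueNode c

module Submission where

-- Attaching each vertex x of G to the neighbour p x of its leaf turns a 3-leaf root into a tree R
-- with a map p such that distinct x, y are adjacent iff p x and p y are equal or adjacent in R;
-- conversely, pruning the leaves of R missed by p and hanging x on p x gives back a 3-leaf root.
--
-- (⇒) Every marker has a neighbour in its label, so every label is an induced subgraph of G and
-- inherits a map p. If p is not injective on a label, a fibre of p gives a split or the label is a
-- clique; otherwise an edge of R or a closed neighbourhood gives a split, or the label is a star.
-- Two stars joined through a clique node would force a triangle in R, and two stars joined at their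
-- centres a 4-cycle.
--
-- (⇐) Call a clique node, or a leaf next to a star node, a bunch; the bunches hang on the subtree of
-- star nodes. Take R = T, and let p send the vertices of a bunch b hanging on the star u to u if b
-- is the centre of u, and to b otherwise. Without star nodes G is complete and p may be constant.

open import Defs
open import Data.Nat using (ℕ; zero; suc; _+_; _≤_; z≤n; s≤s)
open import Data.Nat.Properties using (≤-trans; 1+n≰n; n≤1+n; m≤m+n)
open import Data.Fin using (Fin; zero; suc; _≟_; punchIn; punchOut; splitAt; _↑ˡ_; _↑ʳ_)
open import Data.Fin.Properties
  using (any?; all?; injective⇒≤; punchIn-injective; punchInᵢ≢i; punchOut-cong;
         punchIn-punchOut; punchOut-punchIn; splitAt-↑ˡ; splitAt-↑ʳ; splitAt⁻¹-↑ˡ; splitAt⁻¹-↑ʳ)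
open import Data.Bool using (Bool; true; false)
import Data.Bool.Properties as Bool
open import Data.List using (List; []; _∷_; length; last; lookup)
open import Data.List.Membership.Propositional using (_∈_)
open import Data.List.Membership.Propositional.Properties using (∈-lookup)
open import Data.List.Relation.Binary.Subset.Propositional using (_⊆_)
open import Data.List.Relation.Unary.All using (All; []; _∷_)
import Data.List.Relation.Unary.All as All
open import Data.List.Relation.Unary.Any using (here; there)
open import Data.List.Relation.Unary.AllPairs using ([]; _∷_)
open import Data.List.Relation.Unary.Linked using (Linked; [-]; _∷_)
open import Data.List.Relation.Unary.Unique.Propositional using (Unique)
open import Data.Maybe using (just)
open import Data.Product using (Σ; _×_; _,_; ∃-syntax; proj₁; proj₂)
open import Data.Sum using (_⊎_; inj₁; inj₂; [_,_]′)
open import Data.Unit using (tt)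
open import Data.Empty using (⊥; ⊥-elim)
open import Function.Base using (_∘_)
open import Function.Bundles using (_⇔_; mk⇔; Equivalence)
open import Relation.Nullary using (¬_; Dec; yes; no; ¬?; does; _×-dec_; _⊎-dec_; _→-dec_)
open import Relation.Nullary.Decidable using (dec-true; dec-false)
open import Relation.Binary.Construct.Closure.ReflexiveTransitive using (Star; ε; _◅_)
import Relation.Binary.Construct.Closure.ReflexiveTransitive as Star
open import Relation.Binary.PropositionalEquality
  using (_≡_; _≢_; refl; trans; cong; subst; ≢-sym)
import Relation.Binary.PropositionalEquality as ≡

open Equivalence using (to; from)

-- Length of repetition-free lists.

Unique⇒lookup-injective : ∀ {A : Set} {xs : List A} → Unique xs →
  ∀ {i j} → lookup xs i ≡ lookup xs j → i ≡ j
Unique⇒lookup-injective (_  ∷ _)  {zero}  {zero}  _  = refl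
Unique⇒lookup-injective (px ∷ _)  {zero}  {suc j} eq = ⊥-elim (All.lookup px (∈-lookup j) eq)
Unique⇒lookup-injective (px ∷ _)  {suc i} {zero}  eq = ⊥-elim (All.lookup px (∈-lookup i) (≡.sym eq))
Unique⇒lookup-injective (_  ∷ us) {suc i} {suc j} eq = cong suc (Unique⇒lookup-injective us eq)

Unique⇒length≤ : ∀ {m} {xs : List (Fin m)} → Unique xs → length xs ≤ m
Unique⇒length≤ u = injective⇒≤ (Unique⇒lookup-injective u)

-- Walks without backtracking in a graph.

module GraphLemmas {m : ℕ} (T : Graph m) where

  infix 4 _~_ _~?_
  _~_ : Fin m → Fin m → Set
  _~_ = Adj T

  _~?_ : ∀ x y → Dec (x ~ y)
  x ~? y = adj T x y Bool.≟ true

  ~-sym : ∀ {x y} → x ~ y → y ~ x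
  ~-sym {x} {y} e = trans (sym T y x) e

  ~-irrefl : ∀ {x} → ¬ x ~ x
  ~-irrefl {x} e with trans (≡.sym e) (irrefl T x)
  ... | ()

  ~⇒≢ : ∀ {x y} → x ~ y → x ≢ y
  ~⇒≢ e refl = ~-irrefl e

  leaf? : ∀ v → Dec (IsLeaf T v)
  leaf? v = all? λ a → all? λ b → (v ~? a) →-dec ((v ~? b) →-dec (a ≟ b))

  otherNeighbour : ∀ {u v} → ¬ IsLeaf T v → v ~ u → ∃[ w ] (u ≢ w × v ~ w)
  otherNeighbour {u} {v} node e with any? (λ w → ¬? (u ≟ w) ×-dec (v ~? w))
  ... | yes other = other
  ... | no none = ⊥-elim (node λ a b ea eb → trans (is-u a ea) (≡.sym (is-u b eb)))
    where
    is-u : ∀ a → v ~ a → a ≡ u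
    is-u a ea with u ≟ a
    ... | yes refl = refl
    ... | no u≢a = ⊥-elim (none (a , u≢a , ea))

  walk⇒star : ∀ {x y} ws → Walk T x y ws → Star _~_ x y
  walk⇒star []       (_ , refl)     = ε
  walk⇒star (w ∷ ws) ((e ∷ l) , eq) = e ◅ walk⇒star ws (l , eq)

  star⇒walk : ∀ {x y} → Star _~_ x y → ∃[ ws ] Walk T x y ws
  star⇒walk ε = [] , [-] , refl
  star⇒walk (e ◅ s) with star⇒walk s
  ... | ws , l , eq = _ , e ∷ l , eq

  Near : Fin m → Fin m → Set
  Near x y = x ≡ y ⊎ x ~ y

  near-sym : ∀ {x y} → Near x y → Near y x
  near-sym (inj₁ eq) = inj₁ (≡.sym eq)
  near-sym (inj₂ e)  = inj₂ (~-sym e)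

  -- The second vertex is an index because trails are compared by the edge on which they set out.
  -- `P` constrains consecutive triples: `Turn` forbids backtracking, and the marker condition of a
  -- graph-labelled tree will give accessibility.
  data Trail (P : Fin m → Fin m → Fin m → Set) (a b : Fin m) : Fin m → Set where
    [_]     : a ~ b → Trail P a b b
    _∷⟨_⟩_ : ∀ {c y} → a ~ b → P a b c → Trail P b c y → Trail P a b y

  Turn : Fin m → Fin m → Fin m → Set
  Turn a _ c = a ≢ c

  Reduct : Fin m → Fin m → Fin m → Set
  Reduct = Trail Turn

  first : ∀ {P a b y} → Trail P a b y → a ~ b
  first [ e ]        = e
  first (e ∷⟨ _ ⟩ _) = e

  rest : ∀ {P a b y} → Trail P a b y → List (Fin m)
  rest [ _ ]                = []
  rest (_∷⟨_⟩_ {c} _ _ t) = c ∷ rest t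

  weaken : ∀ {P Q : Fin m → Fin m → Fin m → Set} → (∀ {a b c} → P a b c → Q a b c) →
           ∀ {a b y} → Trail P a b y → Trail Q a b y
  weaken f [ e ]        = [ e ]
  weaken f (e ∷⟨ p ⟩ t) = e ∷⟨ f p ⟩ weaken f t

  linked : ∀ {P a b y} (t : Trail P a b y) → Linked _~_ (a ∷ b ∷ rest t)
  linked [ e ]        = e ∷ [-]
  linked (e ∷⟨ _ ⟩ t) = e ∷ linked t

  last-rest : ∀ {P a b y} (t : Trail P a b y) → last (b ∷ rest t) ≡ just y
  last-rest [ _ ]        = refl
  last-rest (_ ∷⟨ _ ⟩ t) = last-rest t

  end∈ : ∀ {P a b y} (t : Trail P a b y) → y ∈ b ∷ rest t
  end∈ [ _ ]        = here refl
  end∈ (_ ∷⟨ _ ⟩ t) = there (end∈ t)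

  -- The trails overlap in the edge between `v` and `a`, so every triple at the seam lies in one of
  -- them and nothing new has to be checked.
  reverseAppend : ∀ {P} → (∀ {a b c} → P a b c → P c b a) → ∀ {v a x y} →
                  Trail P v a x → Trail P a v y → ∃[ c ] Trail P x c y
  reverseAppend s [ e ]        r = _ , r
  reverseAppend s (e ∷⟨ p ⟩ t) r = reverseAppend s t (~-sym (first t) ∷⟨ s p ⟩ r)

  join : ∀ {P} → (∀ {a b c} → P a b c → P c b a) → ∀ {v a b x y} →
         Trail P v a x → P a v b → Trail P v b y → ∃[ c ] Trail P x c y
  join s t p r = reverseAppend s t (~-sym (first t) ∷⟨ p ⟩ r)

  end-leaf : ∀ {a b y} → IsLeaf T b → Reduct a b y → y ≡ b
  end-leaf lf [ _ ]         = refl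
  end-leaf lf (e ∷⟨ ne ⟩ t) = ⊥-elim (ne (lf _ _ (~-sym e) (first t)))

  -- If `z` is already on the trail, the trail is cut there; otherwise it is extended. The condition
  -- `a ≢ z` keeps the first step.
  snoc : ∀ {a b y z} → Reduct a b y → y ~ z → a ≢ z → Reduct a b z
  snoc [ e ] f a≢z = e ∷⟨ a≢z ⟩ [ f ]
  snoc {b = b} {z = z} (e ∷⟨ ne ⟩ t) f a≢z with b ≟ z
  ... | yes refl = [ e ]
  ... | no b≢z   = e ∷⟨ ne ⟩ snoc t f b≢z

  reduce : ∀ {x y} → Star _~_ x y → x ≡ y ⊎ ∃[ b ] Reduct x b y
  reduce ε = inj₁ refl
  reduce {x} (e ◅ s) with reduce s
  ... | inj₁ refl = inj₂ (_ , [ e ])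
  ... | inj₂ (b , t) with x ≟ b
  ...   | no x≢b = inj₂ (_ , e ∷⟨ x≢b ⟩ t)
  -- The new step is undone by the first step of the reduct, so both are dropped.
  reduce (e ◅ s) | inj₂ (b , [ _ ])        | yes refl = inj₁ refl
  reduce (e ◅ s) | inj₂ (b , _ ∷⟨ _ ⟩ t) | yes refl = inj₂ (_ , t)

  fromUnique : ∀ {a b y} ws → Linked _~_ (a ∷ b ∷ ws) → Unique (a ∷ b ∷ ws) →
               last (b ∷ ws) ≡ just y → Reduct a b y
  fromUnique []       (e ∷ _) _                       refl = [ e ]
  fromUnique (c ∷ ws) (e ∷ l) ((_ ∷ a≢c ∷ _) ∷ u) eq   = e ∷⟨ a≢c ⟩ fromUnique ws l u eq

  noClosed⇒acyclic : (∀ {x b} → ¬ Reduct x b x) → ∀ cs → ¬ Cycle T cs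
  noClosed⇒acyclic nc [] ()
  noClosed⇒acyclic nc (v ∷ []) (() , _)
  noClosed⇒acyclic nc (v ∷ b ∷ []) (s≤s () , _)
  noClosed⇒acyclic nc (v ∷ b ∷ c ∷ ws) (_ , ((v≢b ∷ v≢c ∷ _) ∷ u) , (e ∷ l) , z , eq , z~v) =
    nc (e ∷⟨ v≢c ⟩ snoc (fromUnique ws l u eq) z~v (≢-sym v≢b))

  -- Cuts the path just before `a`. With the step from `z` to `a`, this prefix closes the cycle in
  -- `reduct-unique`.
  pathBefore : ∀ {a b} us → Linked _~_ (b ∷ us) → Unique (b ∷ us) → a ∈ us →
        ∃[ ws ] (Linked _~_ (b ∷ ws) × Unique (a ∷ b ∷ ws) × ws ⊆ us ×
                 ∃[ z ] (last (b ∷ ws) ≡ just z × z ~ a))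
  pathBefore {a} {b} (c ∷ us) (e ∷ l) (pb ∷ u) a∈ with a ≟ c
  ... | yes refl = [] , [-] , (≢-sym (All.head pb) ∷ []) ∷ [] ∷ [] , (λ ()) , b , refl , e
  pathBefore (c ∷ us) (e ∷ l) (pb ∷ u) (here eq) | no a≢c = ⊥-elim (a≢c eq)
  pathBefore {a} {b} (c ∷ us) (e ∷ l) (pb ∷ u) (there a∈) | no a≢c with pathBefore us l u a∈
  ... | ws , lw , ((a≢c' ∷ pa) ∷ uw) , sub , z , eq , z~a =
    c ∷ ws , e ∷ lw ,
    (≢-sym (All.lookup pb (there a∈)) ∷ a≢c' ∷ pa)
      ∷ (All.head pb ∷ All.tabulate (λ i → All.lookup (All.tail pb) (sub i))) ∷ uw ,
    (λ { (here refl) → here refl ; (there i) → there (sub i) }) , z , eq , z~a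

-- Trees: unique paths and the two sides of an edge.

module TreeLemmas {m : ℕ} (T : Graph m) (tree : IsTree T) where
  open GraphLemmas T public

  -- By induction the part after `a` is a path. If it came back to `a`, the piece up to there would
  -- be a cycle; it has at least three vertices because the trail does not turn back at `b`.
  reduct-unique : ∀ {a b y} (t : Reduct a b y) → Unique (a ∷ b ∷ rest t)
  reduct-unique [ e ] = (~⇒≢ e ∷ []) ∷ [] ∷ []
  reduct-unique {a} {b} (_∷⟨_⟩_ {c} e a≢c t) =
    (~⇒≢ e ∷ a≢c ∷ All.tabulate (λ { i refl → fresh i })) ∷ u
    where
    u = reduct-unique t
    fresh : ¬ a ∈ rest t
    fresh a∈ with linked t | u
    ... | l₀ ∷ l | (b≢c ∷ pb) ∷ u' with pathBefore (rest t) l u' a∈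
    ... | [] , _ , _ , _ , z , refl , z~a =
      proj₂ tree (a ∷ b ∷ c ∷ [])
        ( s≤s (s≤s z≤n) , (~⇒≢ e ∷ a≢c ∷ []) ∷ (b≢c ∷ []) ∷ [] ∷ []
        , e ∷ l₀ ∷ [-] , z , refl , z~a )
    ... | ws@(_ ∷ _) , lw , ((_ ∷ pa) ∷ uw) , sub , z , eq , z~a =
      proj₂ tree (a ∷ b ∷ c ∷ ws)
        ( s≤s (s≤s z≤n)
        , (~⇒≢ e ∷ a≢c ∷ pa) ∷ (b≢c ∷ All.tabulate (λ i → All.lookup pb (sub i))) ∷ uw
        , e ∷ l₀ ∷ lw , z , eq , z~a )

  noClosed : ∀ {x b} → ¬ Reduct x b x
  noClosed t with reduct-unique t
  ... | px ∷ _ = All.lookup px (end∈ t) refl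

  star : ∀ x y → Star _~_ x y
  star x y with proj₂ (proj₁ tree) x y
  ... | ws , w = walk⇒star ws w

  reduct : ∀ {x y} → x ≢ y → ∃[ b ] Reduct x b y
  reduct {x} {y} x≢y = [ (λ eq → ⊥-elim (x≢y eq)) , (λ t → t) ]′ (reduce (star x y))

  neighbour : ∀ {x y} → x ≢ y → ∃[ b ] x ~ b
  neighbour x≢y with reduct x≢y
  ... | b , t = b , first t

  first-unique : ∀ {x b b' y} → Reduct x b y → Reduct x b' y → b ≡ b'
  first-unique {b = b} {b'} t t' with b ≟ b'
  ... | yes eq = eq
  ... | no b≢b' = ⊥-elim (noClosed (proj₂ (join ≢-sym t b≢b' t')))

  notBothSides : ∀ {a b z} → Reduct a b z → ¬ Reduct b a z
  notBothSides t t' = noClosed (proj₂ (reverseAppend ≢-sym t t'))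

  -- The path from `a` to `z` either starts with `b` or can be preceded by the step from `b`. With
  -- `notBothSides`, an edge thus cuts the tree into two sides.
  side : ∀ {a b} → a ~ b → ∀ z → Reduct a b z ⊎ Reduct b a z
  side {a} {b} e z with z ≟ a
  ... | yes refl = inj₂ [ ~-sym e ]
  ... | no z≢a with reduct (≢-sym z≢a)
  ...   | c , t with b ≟ c
  ...     | yes refl = inj₁ t
  ...     | no b≢c   = inj₂ (~-sym e ∷⟨ b≢c ⟩ t)

  -- Otherwise the path to one end of the edge could be prolonged to the other end, which would then
  -- lie on both sides.
  crossing : ∀ {a b c d} → Reduct b a c → Reduct a b d → c ~ d → c ≡ a × d ≡ b
  crossing {a} {b} {c} {d} t t' e with d ≟ b | c ≟ a
  ... | yes refl | yes refl = refl , refl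
  ... | no d≢b   | _        = ⊥-elim (notBothSides t' (snoc t e (≢-sym d≢b)))
  ... | yes _    | no c≢a   = ⊥-elim (notBothSides (snoc t' (~-sym e) (≢-sym c≢a)) t)

  module _ {P : Fin m → Fin m → Fin m → Set} (P⇒Turn : ∀ {a b c} → P a b c → a ≢ c) where

    reduced : ∀ {a b y} → Trail P a b y → Reduct a b y
    reduced = weaken P⇒Turn

    peel : ∀ {a b c y} → Trail P a b y → a ≢ c → Reduct b c y → P a b c × Trail P b c y
    peel [ _ ] _ s = ⊥-elim (noClosed s)
    peel (e ∷⟨ p ⟩ t) _ s with first-unique (reduced t) s
    ... | refl = p , t

    -- A converse of `reverseAppend`: paths are unique, so the trail from `x` to `y` must run
    -- through `a` and `v`. Its initial piece is peeled off step by step.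
    unjoin : ∀ {v a c x y} → Reduct v a x → Reduct a v y → Trail P x c y → Trail P a v y
    unjoin [ e ] s t with first-unique (reduced t) s
    ... | refl = t
    unjoin (e ∷⟨ ne ⟩ r) s t =
      proj₂ (peel (unjoin r (~-sym (first r) ∷⟨ ≢-sym ne ⟩ s) t) (≢-sym ne) s)

    module _ (extend : ∀ {u v} → u ~ v → ¬ IsLeaf T v → ∃[ w ] (P u v w × v ~ w)) where

      private
        grow : ∀ k {u v} → u ~ v →
          (∃[ y ] (IsLeaf T y × Trail P u v y)) ⊎ (∃[ y ] Σ (Trail P u v y) λ t → k ≤ length (rest t))
        grow zero e = inj₂ (_ , [ e ] , z≤n)
        grow (suc k) {u} {v} e with leaf? v
        ... | yes lf = inj₁ (_ , lf , [ e ])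
        ... | no node with extend e node
        ...   | w , p , f with grow k f
        ...     | inj₁ (y , lf , t) = inj₁ (y , lf , e ∷⟨ p ⟩ t)
        ...     | inj₂ (y , t , k≤) = inj₂ (y , e ∷⟨ p ⟩ t , s≤s k≤)

      -- Walking on by `extend` never repeats a vertex. Of `m` further vertices after the first two
      -- there are too many, so the walk stops earlier, which happens only at a leaf.
      trailToLeaf : ∀ {u v} → u ~ v → ∃[ y ] (IsLeaf T y × Trail P u v y)
      trailToLeaf e with grow m e
      ... | inj₁ r = r
      ... | inj₂ (y , t , m≤) = ⊥-elim (1+n≰n (≤-trans (s≤s m≤)
              (≤-trans (n≤1+n _) (subst (_≤ m) (length-rest t) (Unique⇒length≤ (reduct-unique (reduced t)))))))
        where
        length-rest : ∀ {a b y} (t : Trail P a b y) →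
          length (a ∷ b ∷ rest (reduced t)) ≡ suc (suc (length (rest t)))
        length-rest [ _ ]        = refl
        length-rest (_ ∷⟨ _ ⟩ t) = cong suc (length-rest t)

-- 3-leaf roots and maps into trees.

open GraphLemmas using (Near)

module _ {m : ℕ} (T : Graph m) where
  open GraphLemmas T hiding (Near)

  -- A walk between the leaves must start with the step to `q` and end with the step from `q'`,
  -- which leaves at most one step for the middle.
  dist≤3⇔near : ∀ {l l' q q'} → IsLeaf T l → IsLeaf T l' → l ~ q → l' ~ q' → l ≢ l' →
                 DistLeq T l l' 3 ⇔ Near T q q'
  dist≤3⇔near {l} {l'} {q} {q'} lf lf' e e' l≢l' = mk⇔ forth back
    where
    forth : DistLeq T l l' 3 → Near T q q'
    forth ([] , (_ , refl) , _) = ⊥-elim (l≢l' refl)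
    -- The leaves are adjacent to each other, so `q` is `l'` and `e'` is the edge sought.
    forth (a ∷ [] , (f ∷ _ , refl) , _) with lf q a e f
    ... | refl = inj₂ e'
    forth (a ∷ b ∷ [] , (f ∷ g ∷ _ , refl) , _) =
      inj₁ (trans (lf q a e f) (lf' a q' (~-sym g) e'))
    forth (a ∷ b ∷ c ∷ [] , (f ∷ g ∷ h ∷ _ , refl) , _) with lf q a e f | lf' q' b e' (~-sym h)
    ... | refl | refl = inj₂ g
    forth (_ ∷ _ ∷ _ ∷ _ ∷ _ , _ , s≤s (s≤s (s≤s ())))
    back : Near T q q' → DistLeq T l l' 3
    back (inj₁ refl) = q ∷ l' ∷ [] , (e ∷ ~-sym e' ∷ [-] , refl) , s≤s (s≤s z≤n)
    back (inj₂ f)    = q ∷ q' ∷ l' ∷ [] , (e ∷ f ∷ ~-sym e' ∷ [-] , refl) , s≤s (s≤s (s≤s z≤n))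

NearMap : ∀ {n k} → Graph n → Graph k → (Fin n → Fin k) → Set
NearMap G R p = ∀ x y → x ≢ y → Adj G x y ⇔ Near R (p x) (p y)

leafPower⇒nearMap : ∀ {n} {G : Graph n} → LeafPower 3 G →
  ∃[ k ] Σ (Graph k) λ R → IsTree R × Σ (Fin n → Fin k) (NearMap G R)
leafPower⇒nearMap {n} {G} (m , T , tree , f , f-inj , f-leaf , _ , f-adj) =
  m , T , tree , p , λ x y x≢y →
    let near = dist≤3⇔near T (f-leaf x) (f-leaf y) (f~p x≢y) (f~p (≢-sym x≢y)) (x≢y ∘ f-inj x y)
    in mk⇔ (to near ∘ to (f-adj x y x≢y)) (from (f-adj x y x≢y) ∘ from near)
  where
  open TreeLemmas T tree
  p : Fin n → Fin m
  p x with any? (f x ~?_)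
  ... | yes (w , _) = w
  -- A default for the root with a single vertex; then no two distinct `x` and `y` exist.
  ... | no _        = f x
  f~p : ∀ {x y} → x ≢ y → f x ~ p x
  f~p {x} {y} x≢y with any? (f x ~?_)
  ... | yes (_ , e) = e
  ... | no none     = ⊥-elim (none (neighbour (x≢y ∘ f-inj x y)))

-- Connectedness survives because the retraction sending v to its neighbour w maps edges to edges
-- or points.
module RemoveLeaf {k : ℕ} (R : Graph (suc k)) (tree : IsTree R)
                  {v w : Fin (suc k)} (leaf-v : IsLeaf R v) (v~w : Adj R v w) where
  open TreeLemmas R tree hiding (Near)

  R⁻ : Graph k
  R⁻ = record
    { adj    = λ a b → adj R (punchIn v a) (punchIn v b)
    ; sym    = λ a b → sym R (punchIn v a) (punchIn v b)
    ; irrefl = λ a → irrefl R (punchIn v a)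
    }

  module R⁻ = GraphLemmas R⁻

  private
    v≢w : v ≢ w
    v≢w = ~⇒≢ v~w

    punchOut-near : ∀ {a b} (v≢a : v ≢ a) (v≢b : v ≢ b) →
                    Near R⁻ (punchOut v≢a) (punchOut v≢b) ⇔ Near R a b
    punchOut-near v≢a v≢b = mk⇔
      (λ { (inj₁ eq) → inj₁ (trans (≡.sym (punchIn-punchOut v≢a))
                               (trans (cong (punchIn v) eq) (punchIn-punchOut v≢b)))
         ; (inj₂ e)  → inj₂ (≡.subst₂ _~_ (punchIn-punchOut v≢a) (punchIn-punchOut v≢b) e) })
      (λ { (inj₁ eq) → inj₁ (punchOut-cong v eq)
         ; (inj₂ e)  → inj₂ (≡.subst₂ _~_ (≡.sym (punchIn-punchOut v≢a))
                                          (≡.sym (punchIn-punchOut v≢b)) e) })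

    retract : Fin (suc k) → Fin k
    retract z with v ≟ z
    ... | yes _  = punchOut v≢w
    ... | no v≢z = punchOut v≢z

    retract-near : ∀ {a b} → a ~ b → Near R⁻ (retract a) (retract b)
    retract-near {a} {b} e with v ≟ a | v ≟ b
    ... | yes refl | yes refl = inj₁ refl
    ... | yes refl | no v≢b   = inj₁ (punchOut-cong v (leaf-v _ _ v~w e))
    ... | no v≢a   | yes refl = inj₁ (punchOut-cong v (leaf-v _ _ (~-sym e) v~w))
    ... | no v≢a   | no v≢b   = from (punchOut-near v≢a v≢b) (inj₂ e)

    retract-punchIn : ∀ a → retract (punchIn v a) ≡ a
    retract-punchIn a with v ≟ punchIn v a
    ... | yes eq = ⊥-elim (punchInᵢ≢i v a (≡.sym eq))
    ... | no _   = trans (punchOut-cong v refl) (punchOut-punchIn v)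

    retract-star : ∀ {a b} → Star _~_ a b → Star R⁻._~_ (retract a) (retract b)
    retract-star ε = ε
    retract-star (e ◅ s) with retract-near e
    ... | inj₁ eq = subst (λ z → Star R⁻._~_ z _) (≡.sym eq) (retract-star s)
    ... | inj₂ e' = e' ◅ retract-star s

    embed : ∀ {a b c} → R⁻.Reduct a b c → Reduct (punchIn v a) (punchIn v b) (punchIn v c)
    embed R⁻.[ e ]             = [ e ]
    embed (e R⁻.∷⟨ a≢c ⟩ t) = e ∷⟨ a≢c ∘ punchIn-injective v _ _ ⟩ embed t

  R⁻-tree : IsTree R⁻
  R⁻-tree =
    ( inhabited (punchOut v≢w)
    , λ x y → R⁻.star⇒walk (≡.subst₂ (Star R⁻._~_) (retract-punchIn x) (retract-punchIn y)
                (retract-star (star (punchIn v x) (punchIn v y)))) ) ,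
    R⁻.noClosed⇒acyclic (noClosed ∘ embed)
    where
    inhabited : ∀ {k} → Fin k → 1 ≤ k
    inhabited {suc k} _ = s≤s z≤n

  restrict : ∀ {n} (G : Graph n) (p : Fin n → Fin (suc k)) (avoids : ∀ x → v ≢ p x) →
             NearMap G R p → NearMap G R⁻ (λ x → punchOut (avoids x))
  restrict G p avoids near x y x≢y = mk⇔
    (from (punchOut-near (avoids x) (avoids y)) ∘ to (near x y x≢y))
    (from (near x y x≢y) ∘ to (punchOut-near (avoids x) (avoids y)))

-- Pruning the missed leaves.

LeavesHit : ∀ {n k} → Graph k → (Fin n → Fin k) → Set
LeavesHit R p = ∀ v → IsLeaf R v → ∃[ x ] p x ≡ v

-- Removing a leaf may expose another missed one, so the recursion is on the number of vertices. As
-- `IsLeaf` admits an isolated vertex, `x₀` is there to give the missed leaf `v` a neighbour: `p x₀`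
-- is a vertex other than `v`.
prune : ∀ {n} (G : Graph n) → Fin n → ∀ k (R : Graph k) → IsTree R → (p : Fin n → Fin k) → NearMap G R p →
  ∃[ k' ] Σ (Graph k') λ R' → IsTree R' × Σ (Fin n → Fin k') λ p' → NearMap G R' p' × LeavesHit R' p'
prune G x₀ zero R tree p near with p x₀
... | ()
prune G x₀ (suc k) R tree p near
  with any? (λ v → GraphLemmas.leaf? R v ×-dec ¬? (any? λ x → p x ≟ v))
... | no none = suc k , R , tree , p , near , hit
  where
  hit : LeavesHit R p
  hit v lf with any? (λ x → p x ≟ v)
  ... | yes h = h
  ... | no ¬h = ⊥-elim (none (v , lf , ¬h))
... | yes (v , lf , missed) =
  prune G x₀ k R⁻ R⁻-tree _ (restrict G p avoids near)
  where
  avoids : ∀ x → v ≢ p x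
  avoids x eq = missed (x , ≡.sym eq)
  open RemoveLeaf R tree lf (proj₂ (TreeLemmas.neighbour R tree (avoids x₀)))

-- Hanging the vertices of the graph on a tree.

module AttachLeaves {n k : ℕ} (R : Graph k) (tree : IsTree R) (p : Fin n → Fin k) where
  open TreeLemmas R tree hiding (Near)

  private
    adj⁺ : Fin k ⊎ Fin n → Fin k ⊎ Fin n → Bool
    adj⁺ (inj₁ a) (inj₁ b) = adj R a b
    adj⁺ (inj₁ a) (inj₂ y) = does (a ≟ p y)
    adj⁺ (inj₂ x) (inj₁ b) = does (b ≟ p x)
    adj⁺ (inj₂ x) (inj₂ y) = false

    adj⁺-sym : ∀ s t → adj⁺ s t ≡ adj⁺ t s
    adj⁺-sym (inj₁ a) (inj₁ b) = sym R a b
    adj⁺-sym (inj₁ a) (inj₂ y) = refl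
    adj⁺-sym (inj₂ x) (inj₁ b) = refl
    adj⁺-sym (inj₂ x) (inj₂ y) = refl

    adj⁺-irrefl : ∀ s → adj⁺ s s ≡ false
    adj⁺-irrefl (inj₁ a) = irrefl R a
    adj⁺-irrefl (inj₂ x) = refl

  R⁺ : Graph (k + n)
  R⁺ = record
    { adj    = λ u v → adj⁺ (splitAt k u) (splitAt k v)
    ; sym    = λ u v → adj⁺-sym (splitAt k u) (splitAt k v)
    ; irrefl = λ u → adj⁺-irrefl (splitAt k u)
    }

  module R⁺ = GraphLemmas R⁺

  old : Fin k → Fin (k + n)
  old a = a ↑ˡ n

  new : Fin n → Fin (k + n)
  new x = k ↑ʳ x

  data View : Fin (k + n) → Set where
    is-old : ∀ a → View (old a)
    is-new : ∀ x → View (new x)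

  view : ∀ v → View v
  view v with splitAt k v in eq
  ... | inj₁ a = subst View (splitAt⁻¹-↑ˡ eq) (is-old a)
  ... | inj₂ x = subst View (splitAt⁻¹-↑ʳ eq) (is-new x)

  new-injective : ∀ {x y} → new x ≡ new y → x ≡ y
  new-injective {x} {y} eq with trans (≡.sym (splitAt-↑ʳ k n x)) (trans (cong (splitAt k) eq) (splitAt-↑ʳ k n y))
  ... | refl = refl

  old-injective : ∀ {a b} → old a ≡ old b → a ≡ b
  old-injective {a} {b} eq with trans (≡.sym (splitAt-↑ˡ k a n)) (trans (cong (splitAt k) eq) (splitAt-↑ˡ k b n))
  ... | refl = refl

  old≢new : ∀ {a x} → old a ≢ new x
  old≢new {a} {x} eq with trans (≡.sym (splitAt-↑ˡ k a n)) (trans (cong (splitAt k) eq) (splitAt-↑ʳ k n x))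
  ... | ()

  old~old : ∀ {a b} → old a R⁺.~ old b ⇔ a ~ b
  old~old {a} {b} rewrite splitAt-↑ˡ k a n | splitAt-↑ˡ k b n = mk⇔ (λ e → e) (λ e → e)

  new~old : ∀ {x b} → new x R⁺.~ old b → b ≡ p x
  new~old {x} {b} rewrite splitAt-↑ˡ k b n | splitAt-↑ʳ k n x with b ≟ p x
  ... | yes eq = λ _ → eq
  ... | no _   = λ ()

  new~p : ∀ x → new x R⁺.~ old (p x)
  new~p x rewrite splitAt-↑ˡ k (p x) n | splitAt-↑ʳ k n x = dec-true (p x ≟ p x) refl

  new≁new : ∀ {x y} → ¬ new x R⁺.~ new y
  new≁new {x} {y} rewrite splitAt-↑ʳ k n x | splitAt-↑ʳ k n y = λ ()

  new~⇒ : ∀ {x v} → new x R⁺.~ v → v ≡ old (p x)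
  new~⇒ {x} {v} e with view v
  ... | is-old b = cong old (new~old e)
  ... | is-new y = ⊥-elim (new≁new e)

  new-leaf : ∀ x → IsLeaf R⁺ (new x)
  new-leaf x a b e f = trans (new~⇒ e) (≡.sym (new~⇒ f))

  foot : ∀ {v} → View v → Fin k
  foot (is-old a) = a
  foot (is-new x) = p x

  foot-star : ∀ {v} (w : View v) → Star R⁺._~_ v (old (foot w))
  foot-star (is-old a) = ε
  foot-star (is-new x) = new~p x ◅ ε

  old-star : ∀ {a b} → Star _~_ a b → Star R⁺._~_ (old a) (old b)
  old-star ε       = ε
  old-star (e ◅ s) = from old~old e ◅ old-star s

  -- New vertices are leaves, so a reduct that sets out along an old edge can meet one only at its
  -- end, where it is replaced by its foot.
  project : ∀ {a b v} → R⁺.Reduct (old a) (old b) v → (w : View v) → Reduct a b (foot w)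
  -- The equations free the indices, which `old` would otherwise block from matching.
  project = go refl refl
    where
    go : ∀ {u u' a b v} → u ≡ old a → u' ≡ old b → R⁺.Reduct u u' v → (w : View v) → Reduct a b (foot w)
    go refl eq R⁺.[ e ] (is-old c) with old-injective eq
    ... | refl = [ to old~old e ]
    go refl eq R⁺.[ e ] (is-new x) = ⊥-elim (old≢new (≡.sym eq))
    go refl refl (R⁺._∷⟨_⟩_ {c} e a≢c t) w with view c
    ... | is-old d = to old~old e ∷⟨ a≢c ∘ cong old ⟩ go refl refl t w
    go {a = a} {b} refl refl (e R⁺.∷⟨ a≢c ⟩ t) w | is-new x = stop w (R⁺.end-leaf (new-leaf x) t)
      where
      stop : ∀ {v} (w : View v) → v ≡ new x → Reduct a b (foot w)
      stop (is-old d) eq = ⊥-elim (old≢new eq)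
      stop (is-new y) eq with new-injective eq
      ... | refl = subst (Reduct a b) (new~old (R⁺.~-sym (R⁺.first t))) [ to old~old e ]

  -- A closed reduct from an old vertex would project to one in `R`. From a new vertex, dropping the
  -- first step gives a reduct from its foot that again projects to a closed one.
  R⁺-noClosed : ∀ {v b} → ¬ R⁺.Reduct v b v
  R⁺-noClosed R⁺.[ e ] = R⁺.~-irrefl e
  R⁺-noClosed {v} {b} (R⁺._∷⟨_⟩_ {c} e v≢c t) = go (view v) (view b) (view c) e v≢c t
    where
    go : ∀ {v b c} → View v → View b → View c → v R⁺.~ b → v ≢ c → ¬ R⁺.Reduct b c v
    go v@(is-old a) (is-old b) _ e v≢c t =
      noClosed (project (from old~old (to old~old e) R⁺.∷⟨ v≢c ⟩ t) v)
    go (is-old a) (is-new x) _ e v≢c t =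
      v≢c (trans (new~⇒ (R⁺.~-sym e)) (≡.sym (new~⇒ (R⁺.first t))))
    go (is-new x) (is-new y) _ e _ _ = new≁new e
    go v@(is-new x) (is-old b) (is-old c) e _ t with new~old e
    ... | refl = noClosed (project t v)
    go (is-new x) (is-old b) (is-new y) e v≢c t = v≢c (R⁺.end-leaf (new-leaf y) t)

  R⁺-tree : IsTree R⁺
  R⁺-tree = (≤-trans (proj₁ (proj₁ tree)) (m≤m+n k n) , connect) , R⁺.noClosed⇒acyclic R⁺-noClosed
    where
    connect : ∀ u v → ∃[ ws ] Walk R⁺ u v ws
    connect u v = R⁺.star⇒walk (foot-star (view u) Star.◅◅ old-star (star _ _)
                    Star.◅◅ Star.reverse R⁺.~-sym (foot-star (view v)))

  -- An old leaf would be a leaf of `R`, hence some `p z`. A second vertex `y` of the graph gives it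
  -- a second neighbour besides `new z`: `new y` if `p y` is the same, and an old one otherwise.
  R⁺-leaf : LeavesHit R p → ∀ {x y : Fin n} → x ≢ y → ∀ v → IsLeaf R⁺ v → ∃[ z ] new z ≡ v
  R⁺-leaf hit {x} {y} x≢y v lf with view v
  ... | is-new z = z , refl
  ... | is-old a
    with hit a (λ b c e f → old-injective (lf _ _ (from old~old e) (from old~old f)))
  ... | z , refl = ⊥-elim (two (other z))
    where
    other : ∀ z → ∃[ y ] z ≢ y
    other z with z ≟ x
    ... | yes refl = y , x≢y
    ... | no z≢x   = x , z≢x
    two : ¬ (∃[ y ] z ≢ y)
    two (y , z≢y) with p z ≟ p y
    ... | yes eq = z≢y (new-injective (lf _ _ (R⁺.~-sym (new~p z))
                     (subst (λ a → old a R⁺.~ new y) (≡.sym eq) (R⁺.~-sym (new~p y)))))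
    ... | no pz≢py with neighbour pz≢py
    ...   | b , e = old≢new (lf _ _ (from old~old e) (R⁺.~-sym (new~p z)))

  near⁺ : ∀ {a b} → Near R⁺ (old a) (old b) ⇔ Near R a b
  near⁺ = mk⇔ (λ { (inj₁ eq) → inj₁ (old-injective eq) ; (inj₂ e) → inj₂ (to old~old e) })
              (λ { (inj₁ refl) → inj₁ refl ; (inj₂ e) → inj₂ (from old~old e) })

  leafPower : ∀ (G : Graph n) → NearMap G R p → LeavesHit R p → ∀ {x y : Fin n} → x ≢ y → LeafPower 3 G
  leafPower G near hit x≢y =
    _ , R⁺ , R⁺-tree , new , (λ _ _ → new-injective) , new-leaf , R⁺-leaf hit x≢y ,
    λ x y x≢y →
      let dist = dist≤3⇔near R⁺ (new-leaf x) (new-leaf y) (new~p x) (new~p y) (x≢y ∘ new-injective)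
      in mk⇔ (from dist ∘ from near⁺ ∘ to (near x y x≢y))
             (from (near x y x≢y) ∘ to near⁺ ∘ to dist)

nearMap⇒leafPower : ∀ {n k} {G : Graph n} → Connected G → (R : Graph k) → IsTree R →
  (p : Fin n → Fin k) → NearMap G R p → LeafPower 3 G
nearMap⇒leafPower {zero} (() , _) _ _ _ _
-- One vertex hung on a one-vertex tree would make two leaves; here `G` is its own root.
nearMap⇒leafPower {suc zero} {G = G} conn _ _ _ _ =
  1 , G , (conn , acyclic) , (λ x → x) , (λ _ _ eq → eq) , (λ { zero zero zero _ _ → refl }) ,
  (λ v _ → v , refl) , (λ { zero zero x≢x → ⊥-elim (x≢x refl) })
  where
  acyclic : ∀ cs → ¬ Cycle G cs
  acyclic (zero ∷ zero ∷ _) (_ , (z≢z ∷ _) ∷ _ , _) = z≢z refl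
  acyclic (zero ∷ []) (() , _)
nearMap⇒leafPower {suc (suc n)} {G = G} conn R tree p near with prune G zero _ R tree p near
... | _ , R' , tree' , p' , near' , hit =
  AttachLeaves.leafPower R' tree' p' G near' hit {zero} {suc zero} λ ()

-- Prime graphs with a near map into a tree are degenerate.

does-true⁻¹ : ∀ {A : Set} (a? : Dec A) → does a? ≡ true → A
does-true⁻¹ (yes a) _ = a

does-false⁻¹ : ∀ {A : Set} (a? : Dec A) → does a? ≡ false → ¬ A
does-false⁻¹ (no ¬a) _ = ¬a

module _ {k r : ℕ} {V : Fin k → Set} {E : Fin k → Fin k → Set}
         (V? : ∀ a → Dec (V a)) (E? : ∀ a b → Dec (E a b))
         (E-sym : ∀ {a b} → E a b → E b a) (E-irrefl : ∀ {a} → ¬ E a a)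
         (R : Graph r) (tree : IsTree R) (p : Fin k → Fin r)
         (near : ∀ {a b} → V a → V b → a ≢ b → E a b ⇔ Near R (p a) (p b))
         (hasNeighbour : ∀ {a} → V a → ∃[ b ] (V b × E a b))
         (prime : Prime V E)
  where
  open TreeLemmas R tree hiding (Near)

  private
    E⇒≢ : ∀ {a b} → E a b → a ≢ b
    E⇒≢ e refl = E-irrefl e

    -- Vertices of one fibre of `p` are adjacent and have the same neighbours outside it. So the
    -- fibre of `p x` is one side of a split as soon as two vertices lie outside. A single outside
    -- vertex has its neighbour in the fibre and thus is adjacent to all of it.
    twins⇒clique : ∀ {x y} → V x → V y → x ≢ y → p x ≡ p y → IsClique V E
    twins⇒clique {x} {y} Vx Vy x≢y px≡py
      with any? (λ w → any? λ w' → V? w ×-dec (V? w' ×-dec (¬? (w ≟ w') ×-dec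
                   (¬? (p w ≟ p x) ×-dec ¬? (p w' ≟ p x)))))
    ... | yes (w , w' , Vw , Vw' , w≢w' , out , out') = ⊥-elim (prime
          ( S , (x , y , x≢y , Vx , Vy , S-in refl , S-in (≡.sym px≡py))
          , (w , w' , w≢w' , Vw , Vw' , S-out out , S-out out') , complete ))
      where
      S : Fin k → Bool
      S h = does (p h ≟ p x)
      S-in : ∀ {h} → p h ≡ p x → S h ≡ true
      S-in {h} = dec-true (p h ≟ p x)
      S-out : ∀ {h} → p h ≢ p x → S h ≡ false
      S-out {h} = dec-false (p h ≟ p x)
      in-S : ∀ {h} → S h ≡ true → p h ≡ p x
      in-S {h} = does-true⁻¹ (p h ≟ p x)
      complete : ∀ a b → V a → V b → S a ≡ false → S b ≡ true →
                 (∃[ c ] (V c × S c ≡ true × E a c)) → (∃[ d ] (V d × S d ≡ false × E b d)) → E a b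
      complete a b Va Vb Sa Sb (c , Vc , Sc , Eac) _ =
        from (near Va Vb a≢b) (subst (Near R (p a)) (trans (in-S Sc) (≡.sym (in-S Sb)))
                                 (to (near Va Vc (E⇒≢ Eac)) Eac))
        where
        a≢b : a ≢ b
        a≢b refl with trans (≡.sym Sa) Sb
        ... | ()
    ... | no ¬two = clique
      where
      in-out : ∀ {a b} → V a → V b → a ≢ b → p a ≡ p x → p b ≢ p x → E a b
      in-out {a} {b} Va Vb a≢b a-in b-out with hasNeighbour Vb
      ... | c , Vc , Ebc with p c ≟ p x
      ...   | yes c-in = from (near Va Vb a≢b) (near-sym (subst (Near R (p b))
                           (trans c-in (≡.sym a-in)) (to (near Vb Vc (E⇒≢ Ebc)) Ebc)))
      ...   | no c-out = ⊥-elim (¬two (b , c , Vb , Vc , E⇒≢ Ebc , b-out , c-out))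
      clique : IsClique V E
      clique a b Va Vb a≢b with p a ≟ p x | p b ≟ p x
      ... | yes a-in | yes b-in = from (near Va Vb a≢b) (inj₁ (trans a-in (≡.sym b-in)))
      ... | yes a-in | no b-out = in-out Va Vb a≢b a-in b-out
      ... | no a-out | yes b-in = E-sym (in-out Vb Va (≢-sym a≢b) b-in a-out)
      ... | no a-out | no b-out = ⊥-elim (¬two (a , b , Va , Vb , a≢b , a-out , b-out))

    Pendant : Fin k → Fin k → Set
    Pendant c y = ∀ {z} → V z → E y z → z ≡ c

    -- No edge leaves the closed neighbourhood of `c`. If a vertex `w` lay outside, so would its
    -- neighbour, and the neighbourhood and its complement would form a split without crossing
    -- edges.
    hub⇒star : ∀ {c} → V c → (∀ {y} → V y → E c y → Pendant c y) → IsStar V E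
    hub⇒star {c} Vc pendant with any? (λ w → V? w ×-dec (¬? (w ≟ c) ×-dec ¬? (E? c w)))
    ... | no none = c , Vc , universal , independent
      where
      universal : ∀ a → V a → a ≢ c → E c a
      universal a Va a≢c with E? c a
      ... | yes e = e
      ... | no ¬e = ⊥-elim (none (a , Va , a≢c , ¬e))
      independent : ∀ a b → V a → V b → a ≢ c → b ≢ c → ¬ E a b
      independent a b Va Vb a≢c b≢c Eab = b≢c (pendant Va (universal a Va a≢c) Vb Eab)
    ... | yes (w , Vw , w≢c , ¬Ecw) with hasNeighbour Vw | hasNeighbour Vc
    ...   | w' , Vw' , Eww' | y , Vy , Ecy = ⊥-elim (prime
      ( S , (c , y , E⇒≢ Ecy , Vc , Vy , S-true (inj₁ refl) , S-true (inj₂ Ecy))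
      , (w , w' , E⇒≢ Eww' , Vw , Vw' , S-false w≢c ¬Ecw , S-false w'≢c ¬Ecw')
      , λ a b Va Vb Sa Sb → λ { (d , Vd , Sd , Ead) _ → ⊥-elim (noEdge Va Vd Sa Sd Ead) } ))
      where
      InHub : Fin k → Set
      InHub h = h ≡ c ⊎ E c h
      inHub? : ∀ h → Dec (InHub h)
      inHub? h = (h ≟ c) ⊎-dec E? c h
      S : Fin k → Bool
      S h = does (inHub? h)
      S-true : ∀ {h} → InHub h → S h ≡ true
      S-true {h} = dec-true (inHub? h)
      S-false : ∀ {h} → h ≢ c → ¬ E c h → S h ≡ false
      S-false {h} h≢c ¬Ech = dec-false (inHub? h) [ h≢c , ¬Ech ]′
      w'≢c : w' ≢ c
      w'≢c refl = ¬Ecw (E-sym Eww')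
      ¬Ecw' : ¬ E c w'
      ¬Ecw' Ecw' = w≢c (pendant Vw' Ecw' Vw (E-sym Eww'))
      noEdge : ∀ {a d} → V a → V d → S a ≡ false → S d ≡ true → ¬ E a d
      noEdge {a} {d} Va Vd Sa Sd Ead
        with does-true⁻¹ (inHub? d) Sd | does-false⁻¹ (inHub? a) Sa
      ... | inj₁ refl | ¬a = ¬a (inj₂ (E-sym Ead))
      ... | inj₂ Ecd  | ¬a = ¬a (inj₁ (pendant Vd Ecd Va (E-sym Ead)))

    module _ (p-injective : ∀ {x y} → V x → V y → p x ≡ p y → x ≡ y) where

      E⇒~ : ∀ {a b} → V a → V b → E a b → p a ~ p b
      E⇒~ Va Vb e with to (near Va Vb (E⇒≢ e)) e
      ... | inj₁ eq = ⊥-elim (E⇒≢ e (p-injective Va Vb eq))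
      ... | inj₂ f  = f

      -- The edge of R between p x and p y cuts R into two sides, which form a split.
      innerEdge⇒split : ∀ {x y x' y'} → V x → V y → V x' → V y' → E x y →
                        E x x' → x' ≢ y → E y y' → y' ≢ x → Split V E
      innerEdge⇒split {x} {y} {x'} {y'} Vx Vy Vx' Vy' Exy Exx' x'≢y Eyy' y'≢x =
        S , (x , x' , E⇒≢ Exx' , Vx , Vx' , S-true [ ~-sym xy ]
              , S-true (~-sym xy ∷⟨ x'≢y ∘ ≡.sym ∘ p-injective Vy Vx' ⟩ [ E⇒~ Vx Vx' Exx' ]))
          , (y , y' , E⇒≢ Eyy' , Vy , Vy' , S-false [ xy ]
              , S-false (xy ∷⟨ y'≢x ∘ ≡.sym ∘ p-injective Vx Vy' ⟩ [ E⇒~ Vy Vy' Eyy' ]))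
          , complete
        where
        xy : p x ~ p y
        xy = E⇒~ Vx Vy Exy
        S : Fin k → Bool
        S h = [ (λ _ → false) , (λ _ → true) ]′ (side xy (p h))
        S-true : ∀ {h} → Reduct (p y) (p x) (p h) → S h ≡ true
        S-true {h} t with side xy (p h)
        ... | inj₁ t' = ⊥-elim (notBothSides t t')
        ... | inj₂ _  = refl
        S-false : ∀ {h} → Reduct (p x) (p y) (p h) → S h ≡ false
        S-false {h} t with side xy (p h)
        ... | inj₁ _  = refl
        ... | inj₂ t' = ⊥-elim (notBothSides t t')
        true-S : ∀ {h} → S h ≡ true → Reduct (p y) (p x) (p h)
        true-S {h} eq with side xy (p h)
        ... | inj₂ t = t
        true-S {h} () | inj₁ _
        false-S : ∀ {h} → S h ≡ false → Reduct (p x) (p y) (p h)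
        false-S {h} eq with side xy (p h)
        ... | inj₁ t = t
        false-S {h} () | inj₂ _
        complete : ∀ a b → V a → V b → S a ≡ false → S b ≡ true →
                   (∃[ c ] (V c × S c ≡ true × E a c)) → (∃[ d ] (V d × S d ≡ false × E b d)) → E a b
        complete a b Va Vb Sa Sb (c , Vc , Sc , Eac) (d , Vd , Sd , Ebd)
          with crossing (true-S Sc) (false-S Sa) (E⇒~ Vc Va (E-sym Eac))
             | crossing (true-S Sb) (false-S Sd) (E⇒~ Vb Vd Ebd)
        ... | _ , a≡y | b≡x , _ with p-injective Va Vy a≡y | p-injective Vb Vx b≡x
        ...   | refl | refl = E-sym Exy

      ¬inner : ∀ {x y x' z} → V x → V y → V x' → V z → E x y → E x x' → x' ≢ y → E y z → z ≡ x
      ¬inner {x} {z = z} Vx Vy Vx' Vz Exy Exx' x'≢y Eyz with z ≟ x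
      ... | yes eq = eq
      ... | no z≢x = ⊥-elim (prime (innerEdge⇒split Vx Vy Vx' Vz Exy Exx' x'≢y Eyz z≢x))

      -- If `x` has two neighbours, `x` is the hub, since an edge to a neighbour that is not pendant
      -- would be an inner edge. If `y` is its only neighbour, then `x` is pendant at `y`, and it
      -- serves as the second neighbour of `y` in the same argument for the others.
      hub : ∀ {x} → V x → ∃[ c ] (V c × ∀ {y} → V y → E c y → Pendant c y)
      hub {x} Vx with hasNeighbour Vx
      ... | y , Vy , Exy with any? (λ x' → V? x' ×-dec (E? x x' ×-dec ¬? (x' ≟ y)))
      ... | yes (x' , Vx' , Exx' , x'≢y) = x , Vx , pendant
        where
        pendant : ∀ {w} → V w → E x w → Pendant x w
        pendant {w} Vw Exw Vz Ewz with x' ≟ w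
        ... | no x'≢w  = ¬inner Vx Vw Vx' Vz Exw Exx' x'≢w Ewz
        ... | yes refl = ¬inner Vx Vw Vy Vz Exw Exy (≢-sym x'≢y) Ewz
      ... | no none = y , Vy , pendant
        where
        pendant : ∀ {w} → V w → E y w → Pendant y w
        pendant {w} Vw Eyw {z} Vz Ewz with x ≟ w
        ... | no x≢w = ¬inner Vy Vw Vx Vz Eyw (E-sym Exy) x≢w Ewz
        ... | yes refl with z ≟ y
        ...   | yes eq = eq
        ...   | no z≢y = ⊥-elim (none (z , Vz , Ewz , z≢y))

  prime⇒degenerate : ∀ {x} → V x → Degenerate V E
  prime⇒degenerate Vx
    with any? (λ x → any? λ y → V? x ×-dec (V? y ×-dec (¬? (x ≟ y) ×-dec (p x ≟ p y))))
  ... | yes (x , y , Vx' , Vy , x≢y , eq) = inj₁ (twins⇒clique Vx' Vy x≢y eq)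
  ... | no ¬twins = let c , Vc , pendant = hub p-injective Vx in inj₂ (hub⇒star Vc pendant)
    where
    p-injective : ∀ {x y} → V x → V y → p x ≡ p y → x ≡ y
    p-injective {x} {y} Vx Vy eq with x ≟ y
    ... | yes x≡y = x≡y
    ... | no x≢y  = ⊥-elim (¬twins (x , y , Vx , Vy , x≢y , eq))

-- Accessibility in the split tree.

module SplitTree {n : ℕ} (G : Graph n) (conn : Connected G) (ST : GLT n) (split : IsSplitTreeOf ST G) where
  open GLT ST
  open TreeLemmas T isTree hiding (Near)
  module G = GraphLemmas G

  Leaf : Fin m → Set
  Leaf = IsLeaf T

  L : Fin m → Fin m → Fin m → Set
  L = LE ST

  Labelled : Fin m → Fin m → Fin m → Set
  Labelled a v b = L v a b

  -- Accessibility without asking for a simple path: markers adjacent in a label are distinct, so a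
  -- thread is a reduct and hence a path.
  Thread : Fin m → Fin m → Fin m → Set
  Thread = Trail Labelled

  L-sym : ∀ {v a b} → L v a b → L v b a
  L-sym {v} {a} {b} e = trans (labSym v b a) e

  L⇒≢ : ∀ {v a b} → L v a b → a ≢ b
  L⇒≢ {v} {a} e refl with trans (≡.sym e) (labIrr v a)
  ... | ()

  thread⇒accessible : ∀ {x b y} → Thread x b y → Accessible ST x y
  thread⇒accessible {x} {b} t =
    (λ { refl → noClosed (reduced L⇒≢ t) }) , b ∷ rest t ,
    ((linked t , last-rest t) , subst (λ ws → Unique (x ∷ b ∷ ws)) (rest-weaken t) (reduct-unique (reduced L⇒≢ t))) ,
    triples t
    where
    rest-weaken : ∀ {a b y} (t : Thread a b y) → rest (reduced L⇒≢ t) ≡ rest t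
    rest-weaken [ _ ]        = refl
    rest-weaken (_ ∷⟨ _ ⟩ t) = cong (_ ∷_) (rest-weaken t)
    triples : ∀ {a b y} (t : Thread a b y) → Triples ST (λ w v w' → L v w w') (a ∷ b ∷ rest t)
    triples [ _ ]        = tt
    triples (_ ∷⟨ p ⟩ t) = p , triples t

  accessible⇒thread : ∀ {x y} → Accessible ST x y → ∃[ b ] Thread x b y
  accessible⇒thread (x≢y , [] , ((_ , refl) , _) , _) = ⊥-elim (x≢y refl)
  accessible⇒thread (_ , b ∷ ws , ((l , eq) , _) , tr) = b , go ws l eq tr
    where
    go : ∀ {a b y} ws → Linked _~_ (a ∷ b ∷ ws) → last (b ∷ ws) ≡ just y →
         Triples ST (λ w v w' → L v w w') (a ∷ b ∷ ws) → Thread a b y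
    go []       (e ∷ _) refl _        = [ e ]
    go (c ∷ ws) (e ∷ l) eq   (p , tr) = e ∷⟨ p ⟩ go ws l eq tr

  leaf-≢ : ∀ {x y} → x ≢ y → leaf x ≢ leaf y
  leaf-≢ x≢y = x≢y ∘ leafInj _ _

  thread⇒adj : ∀ {x b y} → Thread (leaf x) b (leaf y) → Adj G x y
  thread⇒adj t = from (proj₂ (proj₂ split) _ _ (λ { refl → noClosed (reduced L⇒≢ t) })) (thread⇒accessible t)

  adj⇒thread : ∀ {x y} → Adj G x y → ∃[ b ] Thread (leaf x) b (leaf y)
  adj⇒thread e = accessible⇒thread (to (proj₂ (proj₂ split) _ _ (G.~⇒≢ e)) e)

  label⇒adj : ∀ {v a b x y} → Thread v a (leaf x) → Thread v b (leaf y) → L v a b → Adj G x y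
  label⇒adj t s e = thread⇒adj (proj₂ (join L-sym t e s))

  -- The thread between the two leaves runs through `a`, `v`, `b`, and its condition at `v` is the
  -- edge sought. With `label⇒adj`, this makes a label an induced subgraph of `G`.
  adj⇒label : ∀ {v a b x y} → Reduct v a (leaf x) → Reduct v b (leaf y) → a ≢ b → Adj G x y → L v a b
  adj⇒label t s a≢b e =
    proj₁ (peel L⇒≢ (unjoin L⇒≢ t (~-sym (first t) ∷⟨ a≢b ⟩ s) (proj₂ (adj⇒thread e))) a≢b s)

  ends-≢ : ∀ {v a b x y} → Reduct v a (leaf x) → Reduct v b (leaf y) → a ≢ b → x ≢ y
  ends-≢ t s a≢b refl = noClosed (proj₂ (join ≢-sym t a≢b s))

  leafBehind : ∀ {u v} → u ~ v → ∃[ x ] Reduct u v (leaf x)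
  leafBehind e with trailToLeaf (λ ne → ne) (λ e node → otherNeighbour node (~-sym e)) e
  ... | y , lf , t with leafOnto y lf
  ...   | x , refl = x , t

  -- Were the marker of u isolated in the label of v, no leaf behind u would be accessible
  -- from a leaf behind v, although G is connected.
  labelNeighbour : ∀ {u v} → u ~ v → ¬ Leaf v → ∃[ w ] (L v u w × v ~ w)
  labelNeighbour {u} {v} e node with leafBehind (~-sym e) | leafBehind e
  ... | x , tx | y , ty = cross (G.walk⇒star _ (proj₂ (proj₂ conn x y))) tx ty
    where
    cross : ∀ {x y} → Star G._~_ x y → Reduct v u (leaf x) → Reduct u v (leaf y) → ∃[ w ] (L v u w × v ~ w)
    cross ε tx ty = ⊥-elim (notBothSides tx ty)
    cross (_◅_ {j = z} f s) tx ty with side e (leaf z)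
    ... | inj₂ tz = cross s tz ty
    ... | inj₁ tz with unjoin L⇒≢ tx tz (proj₂ (adj⇒thread f))
    ...   | [ _ ]        = ⊥-elim (node (leafLeaf z))
    ...   | _ ∷⟨ p ⟩ t = _ , p , first t

  -- By `labelNeighbour` a thread can be continued at every node that it enters. The leaf where it
  -- ends represents the marker of `v` in the label of `u`.
  leafAlong : ∀ {u v} → u ~ v → ∃[ x ] Thread u v (leaf x)
  leafAlong e with trailToLeaf L⇒≢ labelNeighbour e
  ... | y , lf , t with leafOnto y lf
  ...   | x , refl = x , t

  turn⇒node : ∀ {a b v} → v ~ a → v ~ b → a ≢ b → ¬ Leaf v
  turn⇒node e f a≢b lf = a≢b (lf _ _ e f)

  twoOthers : ∀ {v} → ¬ Leaf v → ∀ c → ∃[ a ] ∃[ b ] (v ~ a × v ~ b × a ≢ b × a ≢ c × b ≢ c)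
  twoOthers {v} node c with proj₁ (proj₁ split) v node
  ... | a , b , d , ea , eb , ed , a≢b , a≢d , b≢d with a ≟ c | b ≟ c
  ...   | yes refl | _        = b , d , eb , ed , b≢d , ≢-sym a≢b , ≢-sym a≢d
  ...   | no a≢c   | yes refl = a , d , ea , ed , a≢d , a≢c , ≢-sym b≢d
  ...   | no a≢c   | no b≢c   = a , b , ea , eb , a≢b , a≢c , b≢c

  third : ∀ {v} → ¬ Leaf v → ∀ s t → ∃[ r ] (v ~ r × r ≢ s × r ≢ t)
  third node s t with twoOthers node s
  ... | a , b , ea , eb , a≢b , a≢s , b≢s with a ≟ t
  ...   | yes refl = b , eb , b≢s , ≢-sym a≢b
  ...   | no a≢t   = a , ea , a≢s , a≢t

  Centre : Fin m → Fin m → Set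
  Centre v = IsCentre (LV ST v) (LE ST v)

  -- Both vertices of a two-vertex star are centres, but nodes of a reduced tree have degree at
  -- least three.
  centre-unique : ∀ {v c c'} → ¬ Leaf v → Centre v c → Centre v c' → c ≡ c'
  centre-unique {v} {c} {c'} node (v~c , univ , _) (_ , _ , indep) with c ≟ c'
  ... | yes eq = eq
  ... | no c≢c' with third node c c'
  ...   | r , e , r≢c , r≢c' = ⊥-elim (indep _ _ v~c e c≢c' r≢c' (univ r e r≢c))

  star≢clique : ∀ {v} → StarNode ST v → ¬ CliqueNode ST v
  star≢clique (node , c , _ , _ , indep) (_ , clique) with twoOthers node c
  ... | a , b , ea , eb , a≢b , a≢c , b≢c = indep a b ea eb a≢c b≢c (clique a b ea eb a≢b)

  labelled-centre : ∀ {v c a b} → Centre v c → v ~ a → v ~ b → L v a b → a ≢ c → b ≡ c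
  labelled-centre {c = c} {b = b} (_ , _ , indep) ea eb e a≢c with b ≟ c
  ... | yes eq = eq
  ... | no b≢c = ⊥-elim (indep _ _ ea eb a≢c b≢c e)

  no-clique-clique : ∀ {u v} → u ~ v → CliqueNode ST u → ¬ CliqueNode ST v
  no-clique-clique e = proj₁ (proj₂ (proj₁ split)) _ _ e

  -- From a near map to the three conditions.

  module FromNearMap {r : ℕ} (R : Graph r) (R-tree : IsTree R) (p : Fin n → Fin r) (near : NearMap G R p) where
    module R = TreeLemmas R R-tree

    near⇒adj : ∀ {x y} → x ≢ y → Near R (p x) (p y) → Adj G x y
    near⇒adj x≢y = from (near _ _ x≢y)

    separated : ∀ {x y z} → Adj G z x → ¬ Adj G z y → z ≢ y → p x ≢ p y
    separated {x} {y} {z} e ¬e z≢y eq =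
      ¬e (near⇒adj z≢y (subst (Near R (p z)) eq (to (near z x (G.~⇒≢ e)) e)))

    adj⇒edge : ∀ {x y} → Adj G x y → p x ≢ p y → p x R.~ p y
    adj⇒edge e ne with to (near _ _ (G.~⇒≢ e)) e
    ... | inj₁ eq = ⊥-elim (ne eq)
    ... | inj₂ f  = f

    noTriangle : ∀ {x y z} → Adj G x y → Adj G y z → Adj G z x →
                 p x ≢ p y → p y ≢ p z → p z ≢ p x → ⊥
    noTriangle e f g x≢y y≢z z≢x =
      R.noClosed (adj⇒edge e x≢y R.∷⟨ ≢-sym z≢x ⟩ (adj⇒edge f y≢z R.∷⟨ ≢-sym x≢y ⟩ R.[ adj⇒edge g z≢x ]))

    -- An induced 4-cycle. Opposite vertices are not adjacent, so their images differ; the images of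
    -- consecutive ones differ because the vertex opposite one of them is adjacent to only the
    -- other. So `R` would contain a closed reduct.
    noSquare : ∀ {x₁ x₂ y₁ y₂} → Adj G x₁ y₁ → Adj G x₁ y₂ → Adj G x₂ y₁ → Adj G x₂ y₂ →
               x₁ ≢ x₂ → ¬ Adj G x₁ x₂ → y₁ ≢ y₂ → ¬ Adj G y₁ y₂ → ⊥
    noSquare e₁₁ e₁₂ e₂₁ e₂₂ x≢ ¬x y≢ ¬y =
      R.noClosed (adj⇒edge e₁₁ (≢-sym (separated e₂₁ (¬x ∘ G.~-sym) (≢-sym x≢)))
        R.∷⟨ far x≢ ¬x ⟩ (adj⇒edge (G.~-sym e₂₁) (separated e₁₁ ¬x x≢)
        R.∷⟨ far y≢ ¬y ⟩ (adj⇒edge e₂₂ (≢-sym (separated e₁₂ ¬x x≢))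
        R.∷⟨ far (≢-sym x≢) (¬x ∘ G.~-sym) ⟩ R.[ adj⇒edge (G.~-sym e₁₂) (separated e₂₂ (¬x ∘ G.~-sym) (≢-sym x≢)) ])))
      where
      far : ∀ {x y} → x ≢ y → ¬ Adj G x y → p x ≢ p y
      far x≢y ¬e eq = ¬e (near⇒adj x≢y (inj₁ eq))

    -- Threads give each marker a representing leaf `rep a`, so the label inherits the near map
    -- `p ∘ rep` and `prime⇒degenerate` applies.
    cliqueOrStar : CliqueStarTree ST
    cliqueOrStar v node = [ (λ prime → classify (degenerate prime)) , classify ]′ (proj₁ (proj₂ split) v node)
      where
      classify : Degenerate (LV ST v) (LE ST v) → CliqueNode ST v ⊎ StarNode ST v
      classify (inj₁ clique) = inj₁ (node , clique)
      classify (inj₂ star)   = inj₂ (node , star)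

      -- Any neighbour will do; the vertex to be avoided is `v`, which is no neighbour of itself.
      a₀ : Fin m
      a₀ = proj₁ (twoOthers node v)
      v~a₀ : v ~ a₀
      v~a₀ = proj₁ (proj₂ (proj₂ (twoOthers node v)))

      -- The value at a non-neighbour of v is irrelevant.
      rep : Fin m → Fin n
      rep a with v ~? a
      ... | yes e = proj₁ (leafAlong e)
      ... | no _  = proj₁ (leafAlong v~a₀)

      rep-thread : ∀ {a} → v ~ a → Thread v a (leaf (rep a))
      rep-thread {a} e with v ~? a
      ... | yes f = proj₂ (leafAlong f)
      ... | no ¬e = ⊥-elim (¬e e)

      label-near : ∀ {a b} → v ~ a → v ~ b → a ≢ b → L v a b ⇔ Near R (p (rep a)) (p (rep b))
      label-near {a} {b} ea eb a≢b = mk⇔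
        (to (near _ _ rep≢) ∘ label⇒adj ta tb)
        (adj⇒label (reduced L⇒≢ ta) (reduced L⇒≢ tb) a≢b ∘ near⇒adj rep≢)
        where
        ta = rep-thread ea
        tb = rep-thread eb
        rep≢ : rep a ≢ rep b
        rep≢ = ends-≢ (reduced L⇒≢ ta) (reduced L⇒≢ tb) a≢b

      degenerate : Prime (LV ST v) (LE ST v) → Degenerate (LV ST v) (LE ST v)
      degenerate prime = prime⇒degenerate (v ~?_) (λ a b → lab v a b Bool.≟ true) L-sym (λ e → L⇒≢ e refl)
        R R-tree (p ∘ rep) label-near
        (λ e → let w , l , f = labelNeighbour (~-sym e) node in w , f , l) prime v~a₀

    -- Whether q is the centre or an extremity of s, some leaf x behind s is told apart from
    -- all leaves behind q by a further leaf behind s.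
    separatingLeaf : ∀ {s q} → StarNode ST s → s ~ q →
      ∃[ x ] (Thread q s (leaf x) × (∀ {y} → Thread s q (leaf y) → p x ≢ p y))
    separatingLeaf {s} {q} (node , c , s~c , univ , indep) s~q with q ≟ c
    ... | yes refl with twoOthers node q
    ...   | a , b , s~a , s~b , a≢b , a≢q , b≢q with leafAlong s~a | leafAlong s~b
    ...     | x , tx | z , tz =
      x , ~-sym s~q ∷⟨ univ a s~a a≢q ⟩ tx ,
      λ ty → ≢-sym (separated (label⇒adj tz ty (L-sym (univ b s~b b≢q)))
               (indep b a s~b s~a b≢q a≢q ∘ adj⇒label (reduced L⇒≢ tz) (reduced L⇒≢ tx) (≢-sym a≢b))
               (ends-≢ (reduced L⇒≢ tz) (reduced L⇒≢ tx) (≢-sym a≢b)))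
    separatingLeaf {s} {q} (node , c , s~c , univ , indep) s~q | no q≢c with third node q c
    ... | b , s~b , b≢q , b≢c with leafAlong s~c | leafAlong s~b
    ...   | x , tx | z , tz =
      x , ~-sym s~q ∷⟨ L-sym (univ q s~q q≢c) ⟩ tx ,
      λ ty → separated (label⇒adj tz tx (L-sym (univ b s~b b≢c)))
               (indep b q s~b s~q b≢c q≢c ∘ adj⇒label (reduced L⇒≢ tz) (reduced L⇒≢ ty) b≢q)
               (ends-≢ (reduced L⇒≢ tz) (reduced L⇒≢ ty) b≢q)

    -- A third neighbour `r` of `q` yields a leaf `z`. With the separating leaves `x` behind `s` and
    -- `y` behind `t` it forms a triangle of `G` with three distinct images.
    noCliqueBetweenStars : ∀ {s q t} → StarNode ST s → CliqueNode ST q → StarNode ST t →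
                           s ~ q → q ~ t → s ≢ t → ⊥
    noCliqueBetweenStars {s} {q} {t} star-s (node , clique) star-t s~q q~t s≢t
      with third node s t | separatingLeaf star-s s~q | separatingLeaf star-t (~-sym q~t)
    ... | r , q~r , r≢s , r≢t | x , tx , sep-x | y , ty , sep-y with leafAlong q~r
    ...   | z , tz = noTriangle
      (label⇒adj tx ty (clique s t q~s q~t s≢t)) (label⇒adj ty tz q-tr)
      (label⇒adj tz tx (clique r s q~r q~s r≢s))
      (sep-x (s~q ∷⟨ clique s t q~s q~t s≢t ⟩ ty))
      (sep-y (~-sym q~t ∷⟨ q-tr ⟩ tz))
      (≢-sym (sep-x (s~q ∷⟨ clique s r q~s q~r (≢-sym r≢s) ⟩ tz)))
      where
      q~s  = ~-sym s~q
      q-tr = clique t r q~t q~r (≢-sym r≢t)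

    -- Follow the path from `u` to `w`. A clique node on it after a star would be followed by a
    -- star, since clique nodes are not adjacent, and so would lie between two stars.
    starNodesConnected : StarNodesConnected ST
    starNodesConnected u w star-u star-w with u ≟ w
    ... | yes refl = [] , ([-] , refl) , star-u ∷ []
    ... | no u≢w   = go star-u (proj₂ (reduct u≢w))
      where
      go : ∀ {u b} → StarNode ST u → Reduct u b w → ∃[ ws ] (Walk T u w ws × All (StarNode ST) (u ∷ ws))
      go star-u [ e ] = w ∷ [] , (e ∷ [-] , refl) , star-u ∷ star-w ∷ []
      go {b = b} star-u (e ∷⟨ u≢c ⟩ t) with cliqueOrStar b (turn⇒node (~-sym e) (first t) u≢c)
      ... | inj₂ star-b with go star-b t
      ...   | ws , (l , eq) , stars = b ∷ ws , (e ∷ l , eq) , star-u ∷ stars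
      go star-u (e ∷⟨ u≢c ⟩ [ f ]) | inj₁ clique-b =
        ⊥-elim (noCliqueBetweenStars star-u clique-b star-w e f u≢c)
      go {b = b} star-u (_∷⟨_⟩_ {c} e u≢c (f ∷⟨ b≢d ⟩ t)) | inj₁ clique-b
        with cliqueOrStar c (turn⇒node (~-sym f) (first t) b≢d)
      ... | inj₁ clique-c = ⊥-elim (no-clique-clique f clique-b clique-c)
      ... | inj₂ star-c   = ⊥-elim (noCliqueBetweenStars star-u clique-b star-c e f u≢c)

    -- If `c` is a star node, reducedness makes `u` its centre. Two extremities on either side then
    -- represent an induced 4-cycle of `G`.
    centresOK : CentresOK ST
    centresOK u star-u@(node-u , _) c centre-c@(u~c , univ-u , indep-u) with leaf? c
    ... | yes lf = inj₁ lf
    ... | no node-c with cliqueOrStar c node-c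
    ...   | inj₁ clique-c = inj₂ clique-c
    ...   | inj₂ star-c@(_ , c' , centre-c'@(_ , univ-c , indep-c)) with c' ≟ u
    ...     | no c'≢u = ⊥-elim (proj₂ (proj₂ (proj₁ split)) u c u~c star-u star-c centre-c
                ((c' , centre-c') , ~-sym u~c , λ centre-u → c'≢u (centre-unique node-c centre-c' centre-u)))
    ...     | yes refl with twoOthers node-u c | twoOthers node-c u
    ...       | a , b , u~a , u~b , a≢b , a≢c , b≢c | d , e , c~d , c~e , d≢e , d≢u , e≢u
                with leafAlong u~a | leafAlong u~b | leafAlong c~d | leafAlong c~e
    ...         | xa , ta | xb , tb | xd , td | xe , te = ⊥-elim (noSquare
                  (label⇒adj ta (u~c ∷⟨ univ-c d c~d d≢u ⟩ td) (L-sym (univ-u a u~a a≢c)))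
                  (label⇒adj ta (u~c ∷⟨ univ-c e c~e e≢u ⟩ te) (L-sym (univ-u a u~a a≢c)))
                  (label⇒adj tb (u~c ∷⟨ univ-c d c~d d≢u ⟩ td) (L-sym (univ-u b u~b b≢c)))
                  (label⇒adj tb (u~c ∷⟨ univ-c e c~e e≢u ⟩ te) (L-sym (univ-u b u~b b≢c)))
                  (ends-≢ (reduced L⇒≢ ta) (reduced L⇒≢ tb) a≢b)
                  (indep-u a b u~a u~b a≢c b≢c ∘ adj⇒label (reduced L⇒≢ ta) (reduced L⇒≢ tb) a≢b)
                  (ends-≢ (reduced L⇒≢ td) (reduced L⇒≢ te) d≢e)
                  (indep-c d e c~d c~e d≢u e≢u ∘ adj⇒label (reduced L⇒≢ td) (reduced L⇒≢ te) d≢e))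

  -- From the three conditions to a near map.

  module FromCliqueStarTree (cliqueOrStar : CliqueStarTree ST) (starsConnected : StarNodesConnected ST)
                            (centresOK : CentresOK ST) where

    Star? : ∀ v → Dec (StarNode ST v)
    Star? v with leaf? v
    ... | yes lf = no λ star → proj₁ star lf
    ... | no node with cliqueOrStar v node
    ...   | inj₁ clique = no λ star → star≢clique star clique
    ...   | inj₂ star   = yes star

    -- The walk of star nodes from `u` to `u'` avoids the clique node `q`, so it stays beyond the
    -- edge from `q` to `u`. Hence the path from `q` to `u'`, a single edge, starts with `u`.
    uniqueStarNeighbour : ∀ {q u u'} → CliqueNode ST q → q ~ u → q ~ u' → StarNode ST u → StarNode ST u' → u ≡ u'
    uniqueStarNeighbour {q} {u} {u'} clique q~u q~u' star-u star-u' with starsConnected u u' star-u star-u'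
    ... | ws , (l , eq) , stars = first-unique (go ws l eq stars [ q~u ]) [ q~u' ]
      where
      go : ∀ {v} ws → Linked _~_ (v ∷ ws) → last (v ∷ ws) ≡ just u' → All (StarNode ST) (v ∷ ws) →
           Reduct q u v → Reduct q u u'
      go []       _       refl _                     t = t
      go (w ∷ ws) (e ∷ l) eq   (_ ∷ stars@(star-w ∷ _)) t =
        go ws l eq stars (snoc t e λ { refl → star≢clique star-w clique })

    data Bunch (x : Fin n) (b : Fin m) : Set where
      single : b ≡ leaf x → Bunch x b
      inClique : CliqueNode ST b → b ~ leaf x → Bunch x b

    record Hook (x : Fin n) (b u : Fin m) : Set where
      field
        bunch  : Bunch x b
        isStar : StarNode ST u
        u~b    : u ~ b
    open Hook

    leaf≢node : ∀ {x v} → ¬ Leaf v → v ≢ leaf x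
    leaf≢node node refl = node (leafLeaf _)

    ¬starBunch : ∀ {x b} → Bunch x b → ¬ StarNode ST b
    ¬starBunch (single refl) (node , _) = node (leafLeaf _)
    ¬starBunch (inClique cl _) star       = star≢clique star cl

    -- The only neighbour of `leaf x` is a star for a single leaf and a clique node otherwise, which
    -- decides the kind of bunch; a clique node has only one star neighbour.
    hook-unique : ∀ {x b u b' u'} → Hook x b u → Hook x b' u' → b ≡ b' × u ≡ u'
    hook-unique {x} h h' with bunch h | bunch h'
    ... | single refl | single refl = refl , leafLeaf x _ _ (~-sym (u~b h)) (~-sym (u~b h'))
    ... | single refl | inClique cl e with leafLeaf x _ _ (~-sym (u~b h)) (~-sym e)
    ...   | refl = ⊥-elim (star≢clique (isStar h) cl)
    hook-unique {x} h h' | inClique cl e | single refl with leafLeaf x _ _ (~-sym (u~b h')) (~-sym e)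
    ...   | refl = ⊥-elim (star≢clique (isStar h') cl)
    hook-unique {x} h h' | inClique cl e | inClique _ e' with leafLeaf x _ _ (~-sym e) (~-sym e')
    ...   | refl = refl , uniqueStarNeighbour cl (~-sym (u~b h)) (~-sym (u~b h')) (isStar h) (isStar h')

    sameStar : ∀ {x b u u'} → Hook x b u → StarNode ST u' → u' ~ b → u ≡ u'
    sameStar h star' e = proj₂ (hook-unique h (record { bunch = bunch h ; isStar = star' ; u~b = e }))

    bunchThread : ∀ {x b u} → Hook x b u → Thread u b (leaf x)
    bunchThread h with bunch h
    ... | single refl = [ u~b h ]
    ... | inClique (_ , cl) e =
      u~b h ∷⟨ cl _ _ (~-sym (u~b h)) e (leaf≢node (proj₁ (isStar h))) ⟩ [ e ]

    -- The vertex of the leaf root to which a bunch b hooked to the star u is attached: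
    -- the central bunch is merged into u.
    data Site (u b : Fin m) : Fin m → Set where
      central : Centre u b → Site u b u
      outer   : ¬ Centre u b → Site u b b

    site : ∀ {u} → StarNode ST u → ∀ b → ∃[ r ] Site u b r
    site {u} (node , c , centre-c) b with c ≟ b
    ... | yes refl = u , central centre-c
    ... | no c≢b   = b , outer (c≢b ∘ centre-unique node centre-c)

    site-unique : ∀ {u b r r'} → Site u b r → Site u b r' → r ≡ r'
    site-unique (central _)  (central _)  = refl
    site-unique (central c)  (outer ¬c)   = ⊥-elim (¬c c)
    site-unique (outer ¬c)   (central c)  = ⊥-elim (¬c c)
    site-unique (outer _)    (outer _)    = refl

    ¬starCentre : ∀ {u v} → StarNode ST u → StarNode ST v → ¬ Centre u v
    ¬starCentre star-u star-v centre with centresOK _ star-u _ centre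
    ... | inj₁ lf     = proj₁ star-v lf
    ... | inj₂ clique = star≢clique star-v clique

    -- Of two markers adjacent in a star exactly one is the centre. Its site is `u`, and the site of
    -- the other is a neighbour of `u`.
    site-near : ∀ {u a b r s} → StarNode ST u → u ~ a → u ~ b → L u a b → Site u a r → Site u b s → r ~ s
    site-near (node , _) u~a u~b e (central ca) (central cb) =
      ⊥-elim (L⇒≢ e (centre-unique node ca cb))
    site-near _ u~a u~b e (central _) (outer _) = u~b
    site-near _ u~a u~b e (outer _) (central _) = ~-sym u~a
    site-near (_ , c , centre) u~a u~b e (outer ¬ca) (outer ¬cb) =
      ⊥-elim (¬cb (subst (Centre _) (≡.sym (labelled-centre centre u~a u~b e λ { refl → ¬ca centre })) centre))

    sameBunch : ∀ {x y b} → x ≢ y → Bunch x b → Bunch y b → Adj G x y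
    sameBunch x≢y (single refl)     (single eq)         = ⊥-elim (leaf-≢ x≢y eq)
    sameBunch x≢y (single refl)     (inClique (node , _) _) = ⊥-elim (node (leafLeaf _))
    sameBunch x≢y (inClique (node , _) _) (single refl)     = ⊥-elim (node (leafLeaf _))
    sameBunch x≢y (inClique (_ , cl) e) (inClique _ f)      = label⇒adj [ e ] [ f ] (cl _ _ e f (leaf-≢ x≢y))

    bunches-apart : ∀ {x y b u b' u'} → Hook x b u → Hook y b' u' → ¬ b ~ b'
    bunches-apart {x} {y} h h' e with bunch h | bunch h'
    ... | single refl | b'-bunch with leafLeaf x _ _ (~-sym (u~b h)) e
    ...   | refl = ¬starBunch b'-bunch (isStar h)
    bunches-apart {x} {y} h h' e | b-bunch@(inClique _ _) | single refl with leafLeaf y _ _ (~-sym (u~b h')) (~-sym e)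
    ...   | refl = ¬starBunch b-bunch (isStar h')
    bunches-apart h h' e | inClique cl _ | inClique cl' _ = no-clique-clique e cl cl'

    central-outer : ∀ {x y b u b' u'} → Hook x b u → Hook y b' u' → Centre u b → ¬ Centre u' b' →
                    u ~ b' → Adj G x y
    central-outer h h' c@(_ , univ , _) ¬c e with sameStar h' (isStar h) e
    ... | refl = label⇒adj (bunchThread h) (bunchThread h') (univ _ e λ { refl → ¬c c })

    -- Equal sites mean the same bunch. Adjacent sites are two stars, whose central bunches see each
    -- other through extremities, or a star and an outer bunch of that same star; two bunches are
    -- never adjacent.
    near⇒adj : ∀ {x y b u b' u' r s} → x ≢ y → Hook x b u → Hook y b' u' → Site u b r → Site u' b' s →
               Near T r s → Adj G x y
    near⇒adj x≢y h h' (central c) (central c') (inj₁ refl) with centre-unique (proj₁ (isStar h)) c c'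
    ... | refl = sameBunch x≢y (bunch h) (bunch h')
    near⇒adj x≢y h h' (central _) (outer _) (inj₁ refl) = ⊥-elim (¬starBunch (bunch h') (isStar h))
    near⇒adj x≢y h h' (outer _) (central _) (inj₁ refl) = ⊥-elim (¬starBunch (bunch h) (isStar h'))
    near⇒adj x≢y h h' (outer _) (outer _) (inj₁ refl)   = sameBunch x≢y (bunch h) (bunch h')
    near⇒adj x≢y h h' (central (_ , univ , _)) (central (_ , univ' , _)) (inj₂ e) =
      label⇒adj (bunchThread h)
        (e ∷⟨ L-sym (univ' _ (~-sym e) λ { refl → ¬starBunch (bunch h') (isStar h) }) ⟩ bunchThread h')
        (univ _ e λ { refl → ¬starBunch (bunch h) (isStar h') })
    near⇒adj x≢y h h' (central c) (outer ¬c) (inj₂ e) = central-outer h h' c ¬c e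
    near⇒adj x≢y h h' (outer ¬c) (central c) (inj₂ e) = G.~-sym (central-outer h' h c ¬c (~-sym e))
    near⇒adj x≢y h h' (outer _) (outer _) (inj₂ e)    = ⊥-elim (bunches-apart h h' e)

    module Sited (hook : ∀ x → ∃[ b ] ∃[ u ] Hook x b u) (p : Fin n → Fin m)
                 (p-site : ∀ {x b u} → Hook x b u → Site u b (p x)) where

      -- If `w` is a leaf or a clique node, it is the bunch of `y`. If `w` is a star, then `u` is an
      -- extremity of it, so the thread goes on through the centre of `w`; thus `y` is in the
      -- central bunch, whose site is `w`.
      thread-site : ∀ {u w y} → StarNode ST u → Thread u w (leaf y) → Site u w (p y)
      thread-site {w = w} star-u t with leaf? w
      ... | yes lf with end-leaf lf (reduced L⇒≢ t)
      ...   | refl = p-site (record { bunch = single refl ; isStar = star-u ; u~b = first t })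
      thread-site {w = w} star-u t | no node-w with cliqueOrStar w node-w
      thread-site star-u [ _ ] | no node-w | _ = ⊥-elim (node-w (leafLeaf _))
      thread-site star-u (_∷⟨_⟩_ {d} e l t) | no _ | inj₁ clique-w with leaf? d
      ... | yes lf with end-leaf lf (reduced L⇒≢ t)
      ...   | refl = p-site (record { bunch = inClique clique-w (first t) ; isStar = star-u ; u~b = e })
      thread-site star-u (_∷⟨_⟩_ {d} e l t) | no _ | inj₁ clique-w | no node-d with cliqueOrStar d node-d
      ... | inj₁ clique-d = ⊥-elim (no-clique-clique (first t) clique-w clique-d)
      ... | inj₂ star-d   = ⊥-elim (L⇒≢ l (uniqueStarNeighbour clique-w (~-sym e) (first t) star-u star-d))
      thread-site star-u (e ∷⟨ l ⟩ t) | no _ | inj₂ star-w@(_ , c , centre-c)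
        with labelled-centre centre-c (~-sym e) (first t) l (λ { refl → ¬starCentre star-w star-u centre-c })
      ... | refl = subst (Site _ _) (site-unique (central centre-c) (thread-site star-w t))
                     (outer (¬starCentre star-u star-w))

      starThread-near : ∀ {x y b u} → Hook x b u → Thread b u (leaf y) → Near T (p x) (p y)
      starThread-near h [ _ ] = ⊥-elim (proj₁ (isStar h) (leafLeaf _))
      starThread-near h (_ ∷⟨ l ⟩ t) =
        inj₂ (site-near (isStar h) (u~b h) (first t) l (p-site h) (thread-site (isStar h) t))

      -- The thread from `leaf x` either ends within its own bunch, where the images agree, or
      -- enters the star `u`, where `site-near` compares the markers on which it enters and leaves.
      adj⇒near : ∀ {x y b u} → Hook x b u → Adj G x y → Near T (p x) (p y)
      adj⇒near {x} h e with bunch h | adj⇒thread e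
      ... | single refl | _ , t with leafLeaf x _ _ (first t) (~-sym (u~b h))
      ...   | refl = starThread-near h t
      adj⇒near {x} h e | inClique cl f | _ , t with leafLeaf x _ _ (first t) (~-sym f)
      adj⇒near {x} h e | inClique cl f | _ , [ _ ] | refl = ⊥-elim (proj₁ cl (leafLeaf _))
      adj⇒near {x} h e | inClique cl f | _ , _∷⟨_⟩_ {d} _ _ t | refl with leaf? d
      ... | yes lf with end-leaf lf (reduced L⇒≢ t)
      ...   | refl = inj₁ (site-unique (p-site h)
                       (p-site (record { bunch = inClique cl (first t) ; isStar = isStar h ; u~b = u~b h })))
      adj⇒near {x} h e | inClique cl f | _ , _∷⟨_⟩_ {d} _ _ t | refl | no node-d with cliqueOrStar d node-d
      ...   | inj₁ clique-d = ⊥-elim (no-clique-clique (first t) cl clique-d)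
      ...   | inj₂ star-d with sameStar h star-d (~-sym (first t))
      ...     | refl = starThread-near h t

      nearMap : NearMap G T p
      nearMap x y x≢y = mk⇔
        (adj⇒near (hooked x))
        (near⇒adj x≢y (hooked x) (hooked y) (p-site (hooked x)) (p-site (hooked y)))
        where
        hooked : ∀ x → Hook x (proj₁ (hook x)) (proj₁ (proj₂ (hook x)))
        hooked x = proj₂ (proj₂ (hook x))

    module WithStar {s₀ : Fin m} (star₀ : StarNode ST s₀) where

      -- On the path from `leaf x` to `s₀` the first node is a star, or it is a clique node and the
      -- second one is a star.
      hook : ∀ x → ∃[ b ] ∃[ u ] Hook x b u
      hook x with reduct (≢-sym (leaf≢node {x} (proj₁ star₀)))
      ... | b , t with leaf? b
      ...   | yes lf = ⊥-elim (proj₁ star₀ (subst Leaf (≡.sym (end-leaf lf t)) lf))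
      ...   | no node-b with cliqueOrStar b node-b
      ...     | inj₂ star-b = leaf x , b , record { bunch = single refl ; isStar = star-b ; u~b = ~-sym (first t) }
      hook x | b , [ _ ] | no _ | inj₁ clique-b = ⊥-elim (star≢clique star₀ clique-b)
      hook x | b , _∷⟨_⟩_ {c} e _ t | no _ | inj₁ clique-b with leaf? c
      ...     | yes lf = ⊥-elim (proj₁ star₀ (subst Leaf (≡.sym (end-leaf lf t)) lf))
      ...     | no node-c with cliqueOrStar c node-c
      ...       | inj₁ clique-c = ⊥-elim (no-clique-clique (first t) clique-b clique-c)
      ...       | inj₂ star-c   = b , c , record
                    { bunch = inClique clique-b (~-sym e) ; isStar = star-c ; u~b = ~-sym (first t) }

      p : Fin n → Fin m
      p x = let b , u , h = hook x in proj₁ (site (isStar h) b)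

      p-site : ∀ {x b u} → Hook x b u → Site u b (p x)
      p-site {x} h with hook x
      ... | b' , u' , h' with hook-unique h h'
      ...   | refl , refl = proj₂ (site (isStar h') b')

    -- All nodes are cliques and no two cliques are adjacent, so a path between leaves has at most
    -- one node.
    noStar⇒complete : (∀ v → ¬ StarNode ST v) → ∀ {x y} → x ≢ y → Adj G x y
    noStar⇒complete noStar x≢y with reduct (leaf-≢ x≢y)
    ... | _ , [ e ] = thread⇒adj [ e ]
    ... | b , _∷⟨_⟩_ {c} e x≢c t with cliqueOrStar b (turn⇒node (~-sym e) (first t) x≢c)
    ...   | inj₂ star-b = ⊥-elim (noStar b star-b)
    ...   | inj₁ clique-b@(_ , cl) with leaf? c
    ...     | yes lf with end-leaf lf t
    ...       | refl = thread⇒adj (e ∷⟨ cl _ _ (~-sym e) (first t) x≢c ⟩ [ first t ])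
    noStar⇒complete noStar x≢y | b , _∷⟨_⟩_ {c} e x≢c t | inj₁ clique-b | no node-c with cliqueOrStar c node-c
    ... | inj₁ clique-c = ⊥-elim (no-clique-clique (first t) clique-b clique-c)
    ... | inj₂ star-c   = ⊥-elim (noStar c star-c)

    leafPower : LeafPower 3 G
    leafPower with any? Star?
    ... | yes (_ , star₀) = nearMap⇒leafPower {G = G} conn T isTree p (Sited.nearMap hook p p-site)
      where open WithStar star₀
    ... | no none = nearMap⇒leafPower {G = G} conn T isTree (λ _ → v₀)
            λ x y x≢y → mk⇔ (λ _ → inj₁ refl)
              (λ _ → noStar⇒complete (λ v star-v → none (v , star-v)) x≢y)
      where
      inhabited : ∀ {k} → 1 ≤ k → Fin k
      inhabited (s≤s _) = zero
      v₀ : Fin m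
      v₀ = inhabited (proj₁ (proj₁ isTree))

mainTheorem6 : ∀ {n : ℕ} (G : Graph n) → Connected G →
    (ST : GLT n) → IsSplitTreeOf ST G →
    (LeafPower 3 G ⇔ (CliqueStarTree ST × StarNodesConnected ST × CentresOK ST))
mainTheorem6 G conn ST split = mk⇔ forth back
  where
  open SplitTree G conn ST split
  forth : LeafPower 3 G → CliqueStarTree ST × StarNodesConnected ST × CentresOK ST
  forth lp with leafPower⇒nearMap {G = G} lp
  ... | _ , R , R-tree , p , near = cliqueOrStar , starNodesConnected , centresOK
    where open FromNearMap R R-tree p near
  back : CliqueStarTree ST × StarNodesConnected ST × CentresOK ST → LeafPower 3 G
  back (cs , conn-stars , centres) = FromCliqueStarTree.leafPower cs conn-stars centres
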